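{- For all integers $d\ge 1$ and $0\le m<d$ there is a constant $f(d,m)>0$, depending only on $d$ and $m$ and not on $n$, such that the following holds for every integer $n\ge 1$. Partition the cube $Q^d=[0,1]^d$ into the $n^d$ small cubes $\prod_{j=1}^d [a_j/n,(a_j+1)/n]$, where $a_j\in\{0,\dots,n-1\}$. If each of these small cubes is colored in one of $m+1$ colors, then there exists a monochromatic connected component consisting of at least $f(d,m)\, n^{d-m}$ small cubes.
   Context: Two small cubes are adjacent (connected) if they have nonempty intersection as closed sets. A monochromatic connected component is a maximal set of small cubes of the same color that is connected under this adjacency relation. -}

module Defs where

open import Data.Nat using (ℕ; suc; ∣_-_∣; _≤_)
open import Data.Fin using (Fin; toℕ)
open import Data.Product using (_×_)
open import Data.Integer using (+_)
open import Data.Rational using (ℚ; _/_)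
open import Relation.Binary.PropositionalEquality using (_≡_)
open import Relation.Binary.Construct.Closure.ReflexiveTransitive using (Star)

-- A small cube of the n^d subdivision of [0,1]^d: the cube
-- ∏_j [a_j/n, (a_j+1)/n] is indexed by a : Fin d → Fin n.
Cube : ℕ → ℕ → Set
Cube d n = Fin d → Fin n

-- Two closed small cubes intersect iff in every coordinate the
-- indices differ by at most 1.
Adjacent : ∀ {d n} → Cube d n → Cube d n → Set
Adjacent {d} a b = (j : Fin d) → ∣ toℕ (a j) - toℕ (b j) ∣ ≤ 1

Coloring : ℕ → ℕ → ℕ → Set
Coloring d n k = Cube d n → Fin k

MonoStep : ∀ {d n k} → Coloring d n k → Cube d n → Cube d n → Set
MonoStep χ a b = Adjacent a b × χ a ≡ χ b

InComponent : ∀ {d n k} → Coloring d n k → Cube d n → Cube d n → Set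
InComponent χ a b = Star (MonoStep χ) a b

ℕtoℚ : ℕ → ℚ
ℕtoℚ k = (+ k) / 1

{-# OPTIONS --safe #-}

-- A cochain is a mod 2 function on finite sequences of cubes (the empty sequence included),
-- considered on cliques, i.e. on sequences of pairwise adjacent cubes. Sending a cube to its
-- monochromatic component maps cliques to simplices of the nerve of the components; these have
-- at most m + 1 vertices, one per colour. Let u(σ) be the pullback of the indicator of a nerve
-- simplex σ. Then δ u(σ) = Σ u(τ) over the simplices τ obtained from σ by adding a vertex, and
-- u(∅) is the unit of degree -1.
--
-- Every cocycle z of the grid is δ of some y whose support is O(n) times larger: contract the
-- grid to a point p one coordinate at a time, and choose p by averaging. By descending induction on
-- the size of σ, z(σ) = u(σ) + Σ y(τ) is a cocycle with primitive y(σ), and the support of z(σ) is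
-- O(n^(m+1-|σ|)) times the number of cubes close to all the components in σ. For σ = ∅ the cocycle
-- z(∅) vanishes on the empty sequence, so y({v}) is nonzero there for some component v. Then
-- z({v}) is nonzero at the centre p chosen for v, which the averaging allows only if its support
-- contains a positive fraction of all cubes: n^d = O(n^m |v|).

module Submission where

-- Finite sums in ℕ and mod 2, counting and averaging.

module FiniteSums where

  open import Data.Bool using (Bool; true; false; _∧_; _∨_; _xor_)
  open import Data.Bool.Properties using (xor-identityʳ; xor-same)
  open import Data.Bool.Solver using (module xor-∧-Solver)
  open import Data.Bool.ListAction using (any)
  open import Data.Nat using (ℕ; suc; _+_; _*_; _≤_; z≤n; s≤s; _≤?_)
  open import Data.Nat.Properties
  open import Data.Nat.Solver using (module +-*-Solver)
  open import Data.List using (List; []; _∷_; _++_; length; map; filter; cartesianProductWith)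
  open import Data.List.Membership.Propositional using (_∈_)
  open import Data.List.Relation.Unary.Any using (here; there)
  open import Data.List.Relation.Unary.All using (All; []; _∷_)
  open import Data.List.Relation.Unary.AllPairs using ([]; _∷_)
  open import Data.List.Relation.Unary.Unique.Propositional using (Unique)
  open import Data.Product using (∃; _×_; _,_; proj₁; proj₂)
  open import Data.Sum using (_⊎_; inj₁; inj₂)
  open import Function using (_∘_)
  open import Relation.Binary.Definitions using (DecidableEquality)
  open import Relation.Binary.PropositionalEquality
  open import Relation.Nullary using (does; yes; no; contradiction)
  open import Relation.Unary using (Decidable)

  ⟦_⟧ : Bool → ℕ
  ⟦ true ⟧  = 1
  ⟦ false ⟧ = 0

  ⟦∨⟧≤ : ∀ a b → ⟦ a ∨ b ⟧ ≤ ⟦ a ⟧ + ⟦ b ⟧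
  ⟦∨⟧≤ true  b = s≤s z≤n
  ⟦∨⟧≤ false b = ≤-refl

  xor-true : ∀ a b → a xor b ≡ true → a ≡ true ⊎ b ≡ true
  xor-true true  b e = inj₁ refl
  xor-true false b e = inj₂ e

  ∧-trueˡ : ∀ a b → a ∧ b ≡ true → a ≡ true
  ∧-trueˡ true b e = refl

  ∧-trueʳ : ∀ a b → a ∧ b ≡ true → b ≡ true
  ∧-trueʳ true b e = e

  ∨-trueʳ : ∀ a b → b ≡ true → a ∨ b ≡ true
  ∨-trueʳ true  b e = refl
  ∨-trueʳ false b e = e

  private variable
    A B : Set

  any-true : ∀ (f : A → Bool) {x xs} → x ∈ xs → f x ≡ true → any f xs ≡ true
  any-true f {xs = y ∷ ys} (here refl) e rewrite e = refl
  any-true f {xs = y ∷ ys} (there x∈)  e = ∨-trueʳ (f y) _ (any-true f x∈ e)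

  ∑ : List A → (A → ℕ) → ℕ
  ∑ []       f = 0
  ∑ (x ∷ xs) f = f x + ∑ xs f

  ∑-mono : ∀ (xs : List A) {f g : A → ℕ} → (∀ x → f x ≤ g x) → ∑ xs f ≤ ∑ xs g
  ∑-mono []       f≤g = z≤n
  ∑-mono (x ∷ xs) f≤g = +-mono-≤ (f≤g x) (∑-mono xs f≤g)

  ∑-cong : ∀ (xs : List A) {f g : A → ℕ} → (∀ x → f x ≡ g x) → ∑ xs f ≡ ∑ xs g
  ∑-cong []       f≡g = refl
  ∑-cong (x ∷ xs) f≡g = cong₂ _+_ (f≡g x) (∑-cong xs f≡g)

  ∑-+ : ∀ (xs : List A) (f g : A → ℕ) → ∑ xs (λ x → f x + g x) ≡ ∑ xs f + ∑ xs g
  ∑-+ []       f g = refl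
  ∑-+ (x ∷ xs) f g rewrite ∑-+ xs f g =
    solve 4 (λ a b c d → (a :+ b) :+ (c :+ d) := (a :+ c) :+ (b :+ d)) refl
      (f x) (g x) (∑ xs f) (∑ xs g)
    where open +-*-Solver

  ∑-* : ∀ (xs : List A) c (f : A → ℕ) → ∑ xs (λ x → c * f x) ≡ c * ∑ xs f
  ∑-* []       c f = sym (*-zeroʳ c)
  ∑-* (x ∷ xs) c f rewrite ∑-* xs c f = sym (*-distribˡ-+ c (f x) (∑ xs f))

  ∑-const : ∀ (xs : List A) c → ∑ xs (λ _ → c) ≡ length xs * c
  ∑-const []       c = refl
  ∑-const (x ∷ xs) c = cong (c +_) (∑-const xs c)

  ∑-swap : ∀ (xs : List A) (ys : List B) (f : A → B → ℕ) →
    ∑ xs (λ x → ∑ ys (f x)) ≡ ∑ ys (λ y → ∑ xs (λ x → f x y))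
  ∑-swap []       ys f = sym (trans (∑-const ys 0) (*-zeroʳ (length ys)))
  ∑-swap (x ∷ xs) ys f rewrite ∑-swap xs ys f =
    sym (∑-+ ys (f x) (λ y → ∑ xs (λ x′ → f x′ y)))

  ∑-++ : ∀ (xs ys : List A) f → ∑ (xs ++ ys) f ≡ ∑ xs f + ∑ ys f
  ∑-++ []       ys f = refl
  ∑-++ (x ∷ xs) ys f rewrite ∑-++ xs ys f = sym (+-assoc (f x) _ _)

  ∑-map : ∀ (h : A → B) (xs : List A) f → ∑ (map h xs) f ≡ ∑ xs (f ∘ h)
  ∑-map h []       f = refl
  ∑-map h (x ∷ xs) f = cong (f (h x) +_) (∑-map h xs f)

  ∑-product : ∀ {C : Set} (h : A → B → C) xs ys f →
    ∑ (cartesianProductWith h xs ys) f ≡ ∑ xs (λ x → ∑ ys (λ y → f (h x y)))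
  ∑-product h []       ys f = refl
  ∑-product h (x ∷ xs) ys f
    rewrite ∑-++ (map (h x) ys) (cartesianProductWith h xs ys) f
          | ∑-map (h x) ys f | ∑-product h xs ys f = refl

  any≤∑ : ∀ (f : A → Bool) xs → ⟦ any f xs ⟧ ≤ ∑ xs (⟦_⟧ ∘ f)
  any≤∑ f []       = z≤n
  any≤∑ f (x ∷ xs) = ≤-trans (⟦∨⟧≤ (f x) _) (+-monoʳ-≤ ⟦ f x ⟧ (any≤∑ f xs))

  ∑≡length-filter : ∀ {P : A → Set} (P? : Decidable P) xs →
    ∑ xs (λ x → ⟦ does (P? x) ⟧) ≡ length (filter P? xs)
  ∑≡length-filter P? [] = refl
  ∑≡length-filter P? (x ∷ xs) with does (P? x)
  ... | true  = cong suc (∑≡length-filter P? xs)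
  ... | false = ∑≡length-filter P? xs

  ∑-average : ∀ (x : A) xs (f : A → ℕ) b → ∑ (x ∷ xs) f ≤ length (x ∷ xs) * b → ∃ λ y → f y ≤ b
  ∑-average x xs f b le with f x ≤? b
  ... | yes p = x , p
  ∑-average x []       f b le | no ¬p =
    contradiction (subst₂ _≤_ (+-identityʳ (f x)) (+-identityʳ b) le) ¬p
  ∑-average x (y ∷ ys) f b le | no ¬p =
    ∑-average y ys f b (+-cancelˡ-≤ b _ _ (≤-trans (+-monoˡ-≤ _ (≰⇒≥ ¬p)) le))

  ⨁ : List A → (A → Bool) → Bool
  ⨁ []       f = false
  ⨁ (x ∷ xs) f = f x xor ⨁ xs f

  ⨁-cong : ∀ (xs : List A) {f g : A → Bool} → (∀ x → f x ≡ g x) → ⨁ xs f ≡ ⨁ xs g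
  ⨁-cong []       f≡g = refl
  ⨁-cong (x ∷ xs) f≡g = cong₂ _xor_ (f≡g x) (⨁-cong xs f≡g)

  ⨁-xor : ∀ (xs : List A) (f g : A → Bool) → ⨁ xs (λ x → f x xor g x) ≡ ⨁ xs f xor ⨁ xs g
  ⨁-xor []       f g = refl
  ⨁-xor (x ∷ xs) f g rewrite ⨁-xor xs f g =
    solve 4 (λ a b c d → (a :+ b) :+ (c :+ d) := (a :+ c) :+ (b :+ d)) refl
      (f x) (g x) (⨁ xs f) (⨁ xs g)
    where open xor-∧-Solver

  ⨁-false : ∀ (xs : List A) {f : A → Bool} → (∀ x → f x ≡ false) → ⨁ xs f ≡ false
  ⨁-false []       f≡0 = refl
  ⨁-false (x ∷ xs) f≡0 rewrite f≡0 x = ⨁-false xs f≡0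

  ⨁-true : ∀ (xs : List A) f → ⨁ xs f ≡ true → ∃ λ x → f x ≡ true
  ⨁-true (x ∷ xs) f e with xor-true (f x) _ e
  ... | inj₁ fx = x , fx
  ... | inj₂ e′ = ⨁-true xs f e′

  -- Off-diagonal terms come in equal pairs and cancel mod 2. For the nerve this plays the part of
  -- δδ = 0, the pairs being the two orders in which two vertices are added.
  ⨁-symmetric : ∀ (xs : List A) (f : A → A → Bool) →
    (∀ x y → f x y ≡ f y x) → (∀ x → f x x ≡ false) →
    ⨁ xs (λ x → ⨁ xs (f x)) ≡ false
  ⨁-symmetric []       f s d = refl
  ⨁-symmetric (x ∷ xs) f s d
    rewrite d x
          | ⨁-xor xs (λ y → f y x) (λ y → ⨁ xs (f y))
          | ⨁-symmetric xs f s d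
          | ⨁-cong xs (λ y → s y x)
          | xor-identityʳ (⨁ xs (f x)) = xor-same (⨁ xs (f x))

  module _ (_≟_ : DecidableEquality A) where

    private
      absent : ∀ y {xs} → All (y ≢_) xs →
        ∑ xs (λ v → ⟦ does (y ≟ v) ⟧) ≡ 0 × ⨁ xs (λ v → does (y ≟ v)) ≡ false
      absent y []           = refl , refl
      absent y (_∷_ {x} y≢x ys) with y ≟ x
      ... | yes y≡x = contradiction y≡x y≢x
      ... | no _    = absent y ys

    ∑-indicator : ∀ y {xs} → Unique xs → ∑ xs (λ v → ⟦ does (y ≟ v) ⟧) ≤ 1
    ∑-indicator y []           = z≤n
    ∑-indicator y (_∷_ {x} x∉ u) with y ≟ x
    ... | yes refl = ≤-reflexive (cong suc (absent y x∉ .proj₁))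
    ... | no _     = ∑-indicator y u

    ⨁-indicator : ∀ y {xs} → Unique xs → y ∈ xs → ⨁ xs (λ v → does (y ≟ v)) ≡ true
    ⨁-indicator y (_∷_ {x} x∉ u) y∈ with y ≟ x | y∈
    ... | yes refl | _           rewrite absent y x∉ .proj₂ = refl
    ... | no y≢x   | here y≡x    = contradiction y≡x y≢x
    ... | no _     | there y∈xs  = ⨁-indicator y u y∈xs

-- Mod 2 cochains on sequences, coboundary and prism operators.

module Cochains (V : Set) where

  open FiniteSums
  open import Data.Bool using (Bool; true; false; _∧_; _xor_)
  open import Data.Bool.Properties using (∧-zeroʳ; xor-same)
  open import Data.Bool.Solver using (module xor-∧-Solver)
  open import Data.List using (List; []; _∷_; map)
  open import Data.List.Relation.Unary.All using (All; []; _∷_)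
  open import Data.Product using (∃; ∃₂; _×_; _,_)
  open import Data.Sum using (inj₁; inj₂)
  open import Function using (_∘_; const)
  open import Relation.Binary.PropositionalEquality

  Cochain : Set
  Cochain = List V → Bool

  -- (ext a b)(t) is the sum over i of a(tᵢ) b(t with tᵢ deleted). The operators ext a commute, square
  -- to zero and are additive in a, which replaces any bookkeeping of orderings of nerve simplices.
  ext : (V → Bool) → Cochain → Cochain
  ext a b []      = false
  ext a b (x ∷ t) = (a x ∧ b t) xor ext a (b ∘ (x ∷_)) t

  δ : Cochain → Cochain
  δ = ext (const true)

  ext-cong : ∀ a {b c : Cochain} → b ≗ c → ext a b ≗ ext a c
  ext-cong a b≗c []      = refl
  ext-cong a b≗c (x ∷ t) = cong₂ _xor_ (cong (a x ∧_) (b≗c t)) (ext-cong a (b≗c ∘ (x ∷_)) t)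

  ext-congˡ : ∀ {a a′ : V → Bool} → a ≗ a′ → ∀ b → ext a b ≗ ext a′ b
  ext-congˡ a≗a′ b []      = refl
  ext-congˡ a≗a′ b (x ∷ t) = cong₂ _xor_ (cong (_∧ b t) (a≗a′ x)) (ext-congˡ a≗a′ (b ∘ (x ∷_)) t)

  ext-false : ∀ a t → ext a (const false) t ≡ false
  ext-false a []      = refl
  ext-false a (x ∷ t) rewrite ∧-zeroʳ (a x) = ext-false a t

  ext-xor : ∀ a b c t → ext a (λ s → b s xor c s) t ≡ ext a b t xor ext a c t
  ext-xor a b c []      = refl
  ext-xor a b c (x ∷ t) rewrite ext-xor a (b ∘ (x ∷_)) (c ∘ (x ∷_)) t =
    solve 5 (λ k p q r s → k :* (p :+ q) :+ (r :+ s) := (k :* p :+ r) :+ (k :* q :+ s)) refl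
      (a x) (b t) (c t) (ext a (b ∘ (x ∷_)) t) (ext a (c ∘ (x ∷_)) t)
    where open xor-∧-Solver

  ext-∧ : ∀ a k b t → ext a (λ s → k ∧ b s) t ≡ k ∧ ext a b t
  ext-∧ a true  b t = refl
  ext-∧ a false b t = ext-false a t

  ext-⨁ : ∀ {I : Set} a (is : List I) (b : I → Cochain) t →
    ext a (λ s → ⨁ is (λ i → b i s)) t ≡ ⨁ is (λ i → ext a (b i) t)
  ext-⨁ a []       b t = ext-false a t
  ext-⨁ a (i ∷ is) b t
    rewrite ext-xor a (b i) (λ s → ⨁ is (λ j → b j s)) t | ext-⨁ a is b t = refl

  ext-falseˡ : ∀ b t → ext (const false) b t ≡ false
  ext-falseˡ b []      = refl
  ext-falseˡ b (x ∷ t) = ext-falseˡ (b ∘ (x ∷_)) t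

  ext-xorˡ : ∀ a a′ b t → ext (λ x → a x xor a′ x) b t ≡ ext a b t xor ext a′ b t
  ext-xorˡ a a′ b []      = refl
  ext-xorˡ a a′ b (x ∷ t) rewrite ext-xorˡ a a′ (b ∘ (x ∷_)) t =
    solve 5 (λ k p q r s → (p :+ q) :* k :+ (r :+ s) := (p :* k :+ r) :+ (q :* k :+ s)) refl
      (b t) (a x) (a′ x) (ext a (b ∘ (x ∷_)) t) (ext a′ (b ∘ (x ∷_)) t)
    where open xor-∧-Solver

  ext-⨁ˡ : ∀ {I : Set} (is : List I) (a : I → V → Bool) b t →
    ext (λ x → ⨁ is (λ i → a i x)) b t ≡ ⨁ is (λ i → ext (a i) b t)
  ext-⨁ˡ []       a b t = ext-falseˡ b t
  ext-⨁ˡ (i ∷ is) a b t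
    rewrite ext-xorˡ (a i) (λ x → ⨁ is (λ j → a j x)) b t | ext-⨁ˡ is a b t = refl

  private
    ext-ext : ∀ a b c x t → ext a (ext b c) (x ∷ t) ≡
      (a x ∧ ext b c t) xor ((b x ∧ ext a c t) xor ext a (ext b (c ∘ (x ∷_))) t)
    ext-ext a b c x t
      rewrite ext-xor a (λ s → b x ∧ c s) (ext b (c ∘ (x ∷_))) t | ext-∧ a (b x) c t = refl

  ext-comm : ∀ a b c t → ext a (ext b c) t ≡ ext b (ext a c) t
  ext-comm a b c []      = refl
  ext-comm a b c (x ∷ t)
    rewrite ext-ext a b c x t | ext-ext b a c x t | ext-comm a b (c ∘ (x ∷_)) t =
    solve 3 (λ p q r → p :+ (q :+ r) := q :+ (p :+ r)) refl
      (a x ∧ ext b c t) (b x ∧ ext a c t) (ext b (ext a (c ∘ (x ∷_))) t)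
    where open xor-∧-Solver

  ext-square : ∀ a c t → ext a (ext a c) t ≡ false
  ext-square a c []      = refl
  ext-square a c (x ∷ t)
    rewrite ext-ext a a c x t | ext-square a (c ∘ (x ∷_)) t =
    solve 1 (λ p → p :+ (p :+ con false) := con false) refl (a x ∧ ext a c t)
    where open xor-∧-Solver

  -- `Q` is carried along so that the entry `x`, and the entries of `t′` left after deleting it, can
  -- still be recognised as entries of `t`.
  ext-true : ∀ {Q : V → Set} a b t → ext a b t ≡ true → All Q t →
    ∃₂ λ x t′ → Q x × a x ≡ true × All Q t′ × b t′ ≡ true
  ext-true a b (x ∷ t) e (q ∷ qs) with xor-true (a x ∧ b t) _ e
  ... | inj₁ e₁ = x , t , q , ∧-trueˡ (a x) _ e₁ , qs , ∧-trueʳ (a x) _ e₁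
  ... | inj₂ e₂ with ext-true a (b ∘ (x ∷_)) t e₂ qs
  ...   | y , t′ , qy , ay , qt′ , bt′ = y , x ∷ t′ , qy , ay , q ∷ qt′ , bt′

  δ-map : ∀ (h : V → V) z t → δ (z ∘ map h) t ≡ δ z (map h t)
  δ-map h z []      = refl
  δ-map h z (x ∷ t) = cong (z (map h t) xor_) (δ-map h (z ∘ (h x ∷_)) t)

  -- The prism operator of a simplicial homotopy from `g` to `h`: the sum over i of `z` on g x₀,
  -- ..., g xᵢ, h xᵢ, ..., h xₖ.
  prism : (g h : V → V) → Cochain → Cochain
  prism g h z []      = false
  prism g h z (x ∷ t) = z (g x ∷ h x ∷ map h t) xor prism g h (z ∘ (g x ∷_)) t

  prism-xor : ∀ g h y z t → prism g h (λ s → y s xor z s) t ≡ prism g h y t xor prism g h z t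
  prism-xor g h y z []      = refl
  prism-xor g h y z (x ∷ t) rewrite prism-xor g h (y ∘ (g x ∷_)) (z ∘ (g x ∷_)) t =
    solve 4 (λ a b c d → (a :+ b) :+ (c :+ d) := (a :+ c) :+ (b :+ d)) refl
      (y (g x ∷ h x ∷ map h t)) (z (g x ∷ h x ∷ map h t))
      (prism g h (y ∘ (g x ∷_)) t) (prism g h (z ∘ (g x ∷_)) t)
    where open xor-∧-Solver

  -- Induction on the sequence, with `g x` absorbed into `z`: `c` and `f` form the identity for the
  -- tail, while `a` and `b` occur twice and cancel mod 2. On the empty sequence both sides vanish.
  prism-homotopy : ∀ g h z t →
    δ (prism g h z) t xor prism g h (δ z) t ≡ z (map g t) xor z (map h t)
  prism-homotopy g h z []      = sym (xor-same (z []))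
  prism-homotopy g h z (x ∷ t)
    rewrite ext-xor (const true) (λ s → z (g x ∷ h x ∷ map h s)) (prism g h (z ∘ (g x ∷_))) t
          | δ-map h (λ s → z (g x ∷ h x ∷ s)) t
          | prism-xor g h z (δ (z ∘ (g x ∷_))) t = begin
      (a xor (b xor c)) xor ((d xor (e xor b)) xor (a xor f))
        ≡⟨ solve 6 (λ a b c d e f → (a :+ (b :+ c)) :+ ((d :+ (e :+ b)) :+ (a :+ f))
                     := (d :+ e) :+ (c :+ f)) refl a b c d e f ⟩
      (d xor e) xor (c xor f)
        ≡⟨ cong ((d xor e) xor_) (prism-homotopy g h (z ∘ (g x ∷_)) t) ⟩
      (d xor e) xor (k xor e)
        ≡⟨ solve 3 (λ d e k → (d :+ e) :+ (k :+ e) := k :+ d) refl d e k ⟩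
      k xor d ∎
    where
    open ≡-Reasoning
    open xor-∧-Solver
    a = prism g h z t
    b = δ (λ s → z (g x ∷ h x ∷ s)) (map h t)
    c = δ (prism g h (z ∘ (g x ∷_))) t
    d = z (h x ∷ map h t)
    e = z (g x ∷ map h t)
    f = prism g h (δ (z ∘ (g x ∷_))) t
    k = z (g x ∷ map g t)

  -- The sequences on which the prism operator evaluates its cochain. Adjacency and traces can be
  -- followed on them with no reference to `z`.
  data PrismTerm (g h : V → V) : List V → List V → Set where
    here  : ∀ {x t} → PrismTerm g h (x ∷ t) (g x ∷ h x ∷ map h t)
    there : ∀ {x t s} → PrismTerm g h t s → PrismTerm g h (x ∷ t) (g x ∷ s)

  prism-true : ∀ g h z t → prism g h z t ≡ true → ∃ λ s → PrismTerm g h t s × z s ≡ true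
  prism-true g h z (x ∷ t) e with xor-true (z (g x ∷ h x ∷ map h t)) _ e
  ... | inj₁ e₁ = _ , here , e₁
  ... | inj₂ e₂ with prism-true g h (z ∘ (g x ∷_)) t e₂
  ...   | s , ps , zs = g x ∷ s , there ps , zs

-- Contractible adjacency spaces and fillings of cocycles.

module Contractions where

  open FiniteSums
  open import Data.Bool using (true; false; _xor_)
  open import Data.Bool.Properties using (xor-same; xor-identityʳ)
  open import Data.Bool.Solver using (module xor-∧-Solver)
  open import Data.List using (List; []; _∷_; map)
  open import Data.List.Properties using (map-id)
  open import Data.List.Membership.Propositional using (_∈_)
  open import Data.List.Membership.Propositional.Properties using (∈-map⁺)
  open import Data.List.Relation.Unary.All using (All; []; _∷_)
  open import Data.List.Relation.Unary.AllPairs using (AllPairs; []; _∷_)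
  open import Data.List.Relation.Unary.Any using (here; there)
  open import Data.Product using (∃; _×_; _,_)
  open import Data.Sum using (inj₁; inj₂)
  open import Function using (_∘_; id; const)
  open import Relation.Binary.Construct.Closure.ReflexiveTransitive using (Star; ε; _◅_)
  open import Relation.Binary.Definitions using (Reflexive; Symmetric)
  open import Relation.Binary.PropositionalEquality hiding ([_])

  -- Contiguity of `g` and `h`: the three adjacency conditions make the prism terms over a clique
  -- cliques again. The trace confines both images of a point, so that supports can be bounded
  -- later.
  record Move {V : Set} (_~_ : V → V → Set) (trace : V → List V) (g h : V → V) : Set where
    field
      source    : ∀ {x y} → x ~ y → g x ~ g y
      target    : ∀ {x y} → x ~ y → h x ~ h y
      across    : ∀ {x y} → x ~ y → g x ~ h y
      g∈trace   : ∀ x → g x ∈ trace x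
      h∈trace   : ∀ x → h x ∈ trace x

  -- A contraction to every point `p` is asked for, because the centre of a filling is chosen
  -- afterwards, according to where the cochain is supported.
  record Contractible (V : Set) : Set₁ where
    field
      _~_        : V → V → Set
      ~-refl     : Reflexive _~_
      ~-sym      : Symmetric _~_
      trace      : V → V → List V
      end∈trace  : ∀ p x → p ∈ trace p x
      contract   : ∀ p → Star (Move _~_ (trace p)) id (const p)

  module Filling {V : Set} (G : Contractible V) where
    open Cochains V
    open Contractible G

    Clique : List V → Set
    Clique = AllPairs _~_

    private module _ {g h : V → V} {tr : V → List V} (m : Move _~_ tr g h) where
      open Move m

      all-h : ∀ {Q : V → Set} {R : V → Set} → (∀ {x} → Q x → R (h x)) →
        ∀ {t} → All Q t → All R (map h t)
      all-h f []       = []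
      all-h f (q ∷ qs) = f q ∷ all-h f qs

      all-term : ∀ {Q : V → Set} {R : V → Set} →
        (∀ {x} → Q x → R (g x)) → (∀ {x} → Q x → R (h x)) →
        ∀ {t s} → PrismTerm g h t s → All Q t → All R s
      all-term f₁ f₂ here       (q ∷ qs) = f₁ q ∷ f₂ q ∷ all-h f₂ qs
      all-term f₁ f₂ (there pt) (q ∷ qs) = f₁ q ∷ all-term f₁ f₂ pt qs

      clique-h : ∀ {t} → Clique t → Clique (map h t)
      clique-h []       = []
      clique-h (q ∷ qs) = all-h target q ∷ clique-h qs

      clique-term : ∀ {t s} → PrismTerm g h t s → Clique t → Clique s
      clique-term here (q ∷ qs) =
        (across ~-refl ∷ all-h across q) ∷ all-h target q ∷ clique-h qs
      clique-term (there pt) (q ∷ qs) =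
        all-term source across pt q ∷ clique-term pt qs

      -- Each entry `x` of `t` leaves at least one of `g x` and `h x` in the prism term, and both
      -- lie in its trace.
      trace-term : ∀ {t s} → PrismTerm g h t s → ∀ {x} → x ∈ t → ∃ λ q → q ∈ s × q ∈ tr x
      trace-term here       (here refl) = _ , here refl , g∈trace _
      trace-term here       (there x∈)  = _ , there (there (∈-map⁺ h x∈)) , h∈trace _
      trace-term (there pt) (here refl) = _ , here refl , g∈trace _
      trace-term (there pt) (there x∈)  with trace-term pt x∈
      ... | q , q∈s , q∈tr = q , there q∈s , q∈tr

    along : ∀ {tr g k} → Star (Move _~_ tr) g k → Cochain → Cochain
    along ε z t = false
    along (_◅_ {g} {h} m ms) z t = prism g h z t xor along ms z t

    -- The prism identities telescope, since each intermediate map occurs in two of them.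
    along-homotopy : ∀ {tr g k} (ms : Star (Move _~_ tr) g k) z t →
      δ (along ms z) t xor along ms (δ z) t ≡ z (map g t) xor z (map k t)
    along-homotopy {g = g} ε z t rewrite ext-false (const true) t = sym (xor-same (z (map g t)))
    along-homotopy {g = g} {k} (_◅_ {j = h} m ms) z t
      rewrite ext-xor (const true) (prism g h z) (along ms z) t = begin
        (a xor b) xor (c xor d)
          ≡⟨ solve 4 (λ a b c d → (a :+ b) :+ (c :+ d) := (a :+ c) :+ (b :+ d)) refl a b c d ⟩
        (a xor c) xor (b xor d)
          ≡⟨ cong₂ _xor_ (prism-homotopy g h z t) (along-homotopy ms z t) ⟩
        (zg xor zh) xor (zh xor zk)
          ≡⟨ solve 3 (λ p q r → (p :+ q) :+ (q :+ r) := p :+ r) refl zg zh zk ⟩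
        zg xor zk ∎
      where
      open ≡-Reasoning
      open xor-∧-Solver
      a = δ (prism g h z) t
      b = δ (along ms z) t
      c = prism g h (δ z) t
      d = along ms (δ z) t
      zg = z (map g t)
      zh = z (map h t)
      zk = z (map k t)

    Traced : (V → List V) → Cochain → List V → Set
    Traced tr z t = ∃ λ s → Clique s × z s ≡ true × (∀ {x} → x ∈ t → ∃ λ q → q ∈ s × q ∈ tr x)

    along-true : ∀ {tr g k} (ms : Star (Move _~_ tr) g k) z {t} → Clique t →
      along ms z t ≡ true → Traced tr z t
    along-true (_◅_ {i = g} {h} m ms) z {t} c e with xor-true (prism g h z t) _ e
    ... | inj₂ e₂ = along-true ms z c e₂
    ... | inj₁ e₁ with prism-true g h z t e₁
    ...   | s , pt , zs = s , clique-term m pt c , zs , trace-term m pt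

    -- The prisms lead to constant sequences, which are not degenerate here; coning them off with one
    -- more p makes the homotopy exact in every degree, in particular on the empty sequence.
    fill : V → Cochain → Cochain
    fill p z t = z (p ∷ map (const p) t) xor along (contract p) z t

    -- The contraction yields `z t` plus `c`, the value on a constant sequence. The cone over `p`
    -- yields `a` twice and `c` once more, which removes it.
    fill-homotopy : ∀ p z t → δ (fill p z) t xor fill p (δ z) t ≡ z t
    fill-homotopy p z t
      rewrite ext-xor (const true) (z ∘ (p ∷_) ∘ map (const p)) (along (contract p) z) t
            | δ-map (const p) (z ∘ (p ∷_)) t = begin
        (a xor b) xor ((c xor a) xor d)
          ≡⟨ solve 4 (λ a b c d → (a :+ b) :+ ((c :+ a) :+ d) := c :+ (b :+ d)) refl a b c d ⟩
        c xor (b xor d)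
          ≡⟨ cong (c xor_) (along-homotopy (contract p) z t) ⟩
        c xor (z (map id t) xor c)
          ≡⟨ solve 2 (λ c e → c :+ (e :+ c) := e) refl c (z (map id t)) ⟩
        z (map id t)
          ≡⟨ cong z (map-id t) ⟩
        z t ∎
      where
      open ≡-Reasoning
      open xor-∧-Solver
      a = δ (z ∘ (p ∷_)) (map (const p) t)
      b = δ (along (contract p) z) t
      c = z (map (const p) t)
      d = along (contract p) (δ z) t

    fill-true : ∀ p z {t} → Clique t → fill p z t ≡ true → Traced (trace p) z t
    fill-true p z {t} c e with xor-true (z (p ∷ map (const p) t)) _ e
    ... | inj₂ e₂ = along-true (contract p) z c e₂
    -- The cone term evaluates `z` on a constant sequence, and `p` lies in the trace of every point.
    ... | inj₁ e₁ = _ , constant (p ∷ t) , e₁ , λ {x} _ → p , here refl , end∈trace p x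
      where
      constant-all : ∀ t → All (p ~_) (map (const p) t)
      constant-all []      = []
      constant-all (_ ∷ t) = ~-refl ∷ constant-all t
      constant : ∀ t → Clique (map (const p) t)
      constant []      = []
      constant (_ ∷ t) = constant-all t ∷ constant t

    along-[] : ∀ {tr g k} (ms : Star (Move _~_ tr) g k) z → along ms z [] ≡ false
    along-[] ε z = refl
    along-[] (m ◅ ms) z = along-[] ms z

    -- Prepares the final count: on the empty sequence no prism contributes, and a primitive reads
    -- off its cocycle at the centre.
    fill-[] : ∀ p z → fill p z [] ≡ z (p ∷ [])
    fill-[] p z rewrite along-[] (contract p) z = xor-identityʳ _

    -- Closedness of `z` on cliques is enough: by `fill-true`, a nonzero value of `fill p (δ z)` on
    -- a clique would come from a clique on which `δ z` is nonzero.
    fill-closed : ∀ p z → (∀ {t} → Clique t → δ z t ≡ false) →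
      ∀ {t} → Clique t → δ (fill p z) t ≡ z t
    fill-closed p z closed {t} c with fill p (δ z) t in eq
    ... | false = trans (sym (trans (cong (δ (fill p z) t xor_) eq)
                                    (xor-identityʳ _)))
                        (fill-homotopy p z t)
    ... | true with fill-true p (δ z) c eq
    ...   | s , cs , δzs , _ with trans (sym δzs) (closed cs)
    ...     | ()

-- The waist estimate: a large class in every labelled colouring.

module Waists where

  open FiniteSums
  open Contractions
  open import Data.Bool using (Bool; true; false; _∧_; _∨_; _xor_)
  open import Data.Bool.ListAction using (any)
  open import Data.Bool.Properties using (xor-identityʳ; ∧-zeroʳ; ∧-identityʳ; ∨-identityʳ)
  open import Data.Bool.Solver using (module xor-∧-Solver)
  open import Data.Fin using (Fin; zero; suc)
  import Data.Fin.Properties as Fin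
  open import Data.List using (List; []; _∷_; length)
  open import Data.List.Membership.Propositional using (_∈_)
  open import Data.List.Relation.Unary.All using (All; []; _∷_)
  import Data.List.Relation.Unary.All as All
  open import Data.List.Relation.Unary.AllPairs using ([]; _∷_)
  open import Data.List.Relation.Unary.Any using (here; there)
  open import Data.List.Relation.Unary.Unique.Propositional using (Unique)
  open import Data.Maybe using (Maybe; just; nothing; maybe′)
  open import Data.Nat using (ℕ; zero; suc; _+_; _*_; _≤_; z≤n)
  open import Data.Nat.Properties hiding (_≟_)
  open import Data.Product using (∃; _×_; _,_; proj₁; proj₂)
  open import Data.Sum using (inj₁; inj₂)
  open import Data.Vec using (Vec; []; _∷_; lookup; _[_]≔_; replicate)
  open import Data.Vec.Properties using ([]≔-lookup; []≔-commutes; lookup∘update; lookup∘update′; lookup-replicate)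
  open import Function using (_∘_; const; id)
  open import Relation.Binary.Definitions using (Decidable; DecidableEquality)
  open import Relation.Binary.PropositionalEquality hiding ([_])
  open import Relation.Nullary using (Dec; does; yes; no; contradiction)

  does-true : ∀ {P : Set} (P? : Dec P) → does P? ≡ true → P
  does-true (yes p) _ = p

  true-does : ∀ {P : Set} (P? : Dec P) → P → does P? ≡ true
  true-does (yes _) _ = refl
  true-does (no ¬p) p = contradiction p ¬p

  record Space (V : Set) : Set₁ where
    field
      contractible : Contractible V
    open Contractible contractible public
    field
      _≟_      : DecidableEquality V
      points   : List V
      unique   : Unique points
      complete : ∀ v → v ∈ points
      _~?_     : Decidable _~_
      degree   : ℕ
      degree-bound : ∀ x → ∑ points (λ y → ⟦ does (x ~? y) ⟧) ≤ degree

    size : (V → Bool) → ℕ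
    size Z = ∑ points (⟦_⟧ ∘ Z)

    -- By `fill-true`, if the cliques on which a cochain is nonzero lie in `Z`, then those on which
    -- its filling with centre `p` is nonzero lie in the shadow.
    shadow : V → (V → Bool) → V → Bool
    shadow p Z x = any Z (trace p x)

    field
      dilation capacity : ℕ
      -- The first bound is the isoperimetric cost of a filling. The second allows a centre inside
      -- `Z` only if `Z` is a definite fraction of the space; it yields the final estimate.
      centre : ∀ Z → ∃ λ p → size (shadow p Z) ≤ dilation * size Z ×
                             (Z p ≡ true → length points ≤ capacity * size Z)

    -- Mirrors the recursion for supports: 1 for the points near the simplex, the product for the
    -- shadows of the fillings over all ways to add a vertex.
    growth : ℕ → ℕ
    growth zero    = 1
    growth (suc j) = 1 + dilation * growth j * degree

  -- A component is named by a point, so that nerve vertices are again elements of `V`. By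
  -- `label-local`, two different vertices of one colour span no nerve simplex.
  record Labelling {V : Set} (G : Contractible V) (k : ℕ) : Set where
    open Contractible G
    field
      colour       : V → Fin k
      label        : V → V
      colour-label : ∀ x → colour (label x) ≡ colour x
      label-local  : ∀ {x y} → x ~ y → colour x ≡ colour y → label x ≡ label y

  module _ {V : Set} (S : Space V) {k : ℕ} (Λ : Labelling (Space.contractible S) k) where
    open Cochains V
    open Space S
    open Filling contractible
    open Labelling Λ

    -- Pullbacks of nerve simplices and their coboundary.

    class : V → V → Bool
    class v x = does (label x ≟ v)

    -- A simplex of the nerve has at most one label of each colour; slot c holds the one of colour c.
    Simplex : ℕ → Set
    Simplex = Vec (Maybe V)

    unit : Cochain
    unit []      = true
    unit (_ ∷ _) = false

    pullback : ∀ {j} → Simplex j → Cochain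
    pullback []            = unit
    pullback (nothing ∷ σ) = pullback σ
    pullback (just v ∷ σ)  = ext (class v) (pullback σ)

    -- `ext-comm` brings slot `c` to the front past the occupied slots.
    pullback-update : ∀ {j} (σ : Simplex j) c v →
      pullback (σ [ c ]≔ just v) ≗ ext (class v) (pullback (σ [ c ]≔ nothing))
    pullback-update (_ ∷ σ)       zero    v t = refl
    pullback-update (nothing ∷ σ) (suc c) v t = pullback-update σ c v t
    pullback-update (just w ∷ σ)  (suc c) v t =
      trans (ext-cong (class w) (pullback-update σ c v) t) (ext-comm (class w) (class v) _ t)

    update-≡ : ∀ {j} (σ : Simplex j) c {m} → lookup σ c ≡ m → σ [ c ]≔ m ≡ σ
    update-≡ σ c refl = []≔-lookup σ c

    insert : V → Simplex k → Maybe (Simplex k)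
    insert v σ = maybe′ (const nothing) (just (σ [ colour v ]≔ just v)) (lookup σ (colour v))

    clique-∈ : ∀ {t x y} → Clique t → x ∈ t → y ∈ t → x ~ y
    clique-∈ (q ∷ qs) (here refl) (here refl) = ~-refl
    clique-∈ (q ∷ qs) (here refl) (there y∈)  = All.lookup q y∈
    clique-∈ (q ∷ qs) (there x∈)  (here refl) = ~-sym (All.lookup q x∈)
    clique-∈ (q ∷ qs) (there x∈)  (there y∈)  = clique-∈ qs x∈ y∈

    -- A nonzero value would need points `x` and `y` of the clique with labels `v` and `w`. They are
    -- adjacent and of equal colour, so `v` and `w` coincide, and then the operator squares to zero.
    ext-same-colour : ∀ v w b {t} → Clique t → colour v ≡ colour w →
      ext (class v) (ext (class w) b) t ≡ false
    ext-same-colour v w b {t} ct cvw with ext (class v) (ext (class w) b) t in eq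
    ... | false = refl
    ... | true with ext-true (class v) (ext (class w) b) t eq (All.tabulate id)
    ...   | x , t′ , x∈ , ex , t′⊆t , e with ext-true (class w) b t′ e t′⊆t
    ...     | y , _ , y∈ , ey , _ with does-true (label x ≟ v) ex | does-true (label y ≟ w) ey
    ...       | refl | refl with label-local (clique-∈ ct x∈ y∈)
                                   (trans (sym (colour-label x)) (trans cvw (colour-label y)))
    ...         | lxy = trans (sym eq) (trans (cong (λ u → ext (class u) (ext (class (label y)) b) t) lxy)
                                              (ext-square (class (label y)) b t))

    Rainbow : Simplex k → Set
    Rainbow σ = ∀ c {w} → lookup σ c ≡ just w → colour w ≡ c

    ext-class-pullback : ∀ v σ {t} → Rainbow σ → Clique t →
      ext (class v) (pullback σ) t ≡ maybe′ (λ τ → pullback τ t) false (insert v σ)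
    ext-class-pullback v σ {t} rb ct with lookup σ (colour v) in eq
    ... | nothing = sym (trans (pullback-update σ (colour v) v t)
                               (cong (λ τ → ext (class v) (pullback τ) t) (update-≡ σ (colour v) eq)))
    ... | just w = begin
      ext (class v) (pullback σ) t
        ≡⟨ cong (λ τ → ext (class v) (pullback τ) t) (sym (update-≡ σ (colour v) eq)) ⟩
      ext (class v) (pullback (σ [ colour v ]≔ just w)) t
        ≡⟨ ext-cong (class v) (pullback-update σ (colour v) w) t ⟩
      ext (class v) (ext (class w) (pullback (σ [ colour v ]≔ nothing))) t
        ≡⟨ ext-same-colour v w _ ct (sym (rb (colour v) eq)) ⟩
      false ∎
      where open ≡-Reasoning

    -- Every point has exactly one label, so the class indicators sum to the constant `true` and `δ`
    -- splits into the operators `ext (class v)`.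
    δ-pullback : ∀ σ {t} → Rainbow σ → Clique t →
      δ (pullback σ) t ≡ ⨁ points (λ v → maybe′ (λ τ → pullback τ t) false (insert v σ))
    δ-pullback σ {t} rb ct = begin
      δ (pullback σ) t
        ≡⟨ ext-congˡ (λ x → sym (⨁-indicator _≟_ (label x) unique (complete (label x)))) (pullback σ) t ⟩
      ext (λ x → ⨁ points (λ v → class v x)) (pullback σ) t
        ≡⟨ ext-⨁ˡ points class (pullback σ) t ⟩
      ⨁ points (λ v → ext (class v) (pullback σ) t)
        ≡⟨ ⨁-cong points (λ v → ext-class-pullback v σ rb ct) ⟩
      ⨁ points (λ v → maybe′ (λ τ → pullback τ t) false (insert v σ)) ∎
      where open ≡-Reasoning

    -- The number of missing colours; descending induction on the size of a simplex becomes
    -- induction on it.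
    holes : ∀ {j} → Simplex j → ℕ
    holes []            = 0
    holes (nothing ∷ σ) = suc (holes σ)
    holes (just _ ∷ σ)  = holes σ

    holes-update : ∀ {j} (σ : Simplex j) c v → lookup σ c ≡ nothing →
      holes σ ≡ suc (holes (σ [ c ]≔ just v))
    holes-update (nothing ∷ σ) zero    v eq = refl
    holes-update (nothing ∷ σ) (suc c) v eq = cong suc (holes-update σ c v eq)
    holes-update (just _ ∷ σ)  (suc c) v eq = holes-update σ c v eq

    insert-holes : ∀ v σ {τ} → insert v σ ≡ just τ → holes σ ≡ suc (holes τ)
    insert-holes v σ e with lookup σ (colour v) in eq
    insert-holes v σ refl | nothing = holes-update σ (colour v) v eq

    insert-rainbow : ∀ v σ {τ} → insert v σ ≡ just τ → Rainbow σ → Rainbow τ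
    insert-rainbow v σ e rb c with lookup σ (colour v)
    insert-rainbow v σ refl rb c | nothing with c Fin.≟ colour v
    ... | yes refl rewrite lookup∘update (colour v) σ (just v) = λ { refl → refl }
    ... | no c≢    rewrite lookup∘update′ c≢ σ (just v) = rb c

    insert² : (Simplex k → Bool) → Simplex k → V → V → Bool
    insert² f σ v w = maybe′ (λ τ → maybe′ f false (insert w τ)) false (insert v σ)

    insert²-same-colour : ∀ f σ v w → colour v ≡ colour w → insert² f σ v w ≡ false
    insert²-same-colour f σ v w cvw with lookup σ (colour v)
    ... | just _  = refl
    ... | nothing rewrite sym cvw | lookup∘update (colour v) σ (just v) = refl

    -- Vertices of distinct colours enter distinct slots, and such updates commute. For equal
    -- colours both orders give `false`.
    insert²-sym : ∀ f σ v w → insert² f σ v w ≡ insert² f σ w v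
    insert²-sym f σ v w with colour v Fin.≟ colour w
    ... | yes cvw = trans (insert²-same-colour f σ v w cvw) (sym (insert²-same-colour f σ w v (sym cvw)))
    ... | no cvw with lookup σ (colour v) in eqv | lookup σ (colour w) in eqw
    ...   | just _  | just _  = refl
    ...   | just _  | nothing rewrite lookup∘update′ cvw σ (just w) | eqv = refl
    ...   | nothing | just _  rewrite lookup∘update′ (cvw ∘ sym) σ (just v) | eqw = refl
    ...   | nothing | nothing
            rewrite lookup∘update′ cvw σ (just w) | eqv
                  | lookup∘update′ (cvw ∘ sym) σ (just v) | eqw =
            cong f ([]≔-commutes σ (colour v) (colour w) cvw)

    -- Cocycles attached to simplices and the sets that carry them.

    meets : V → V → Bool
    meets v x = any (λ y → does (x ~? y) ∧ class v y) points

    near : ∀ {j} → Simplex j → V → Bool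
    near []            x = true
    near (nothing ∷ σ) x = near σ x
    near (just v ∷ σ)  x = meets v x ∧ near σ x

    -- These sets are defined with no reference to cochains, so that the centres can be chosen from
    -- them first and the cocycles then built with these centres.
    support extra : ℕ → Simplex k → V → Bool
    support j σ x = near σ x ∨ extra j σ x
    extra zero    σ x = false
    extra (suc j) σ x =
      any (λ v → maybe′ (λ τ → shadow (proj₁ (centre (support j τ))) (support j τ) x) false (insert v σ)) points

    centre-of : ℕ → Simplex k → V
    centre-of j σ = proj₁ (centre (support j σ))

    -- The counter `j` is fuel, sufficient when `holes σ ≤ j`: at zero all colours are then present,
    -- nothing can be inserted and no correction is due.
    cocycle correction : ℕ → Simplex k → Cochain
    cocycle j σ t = pullback σ t xor correction j σ t
    correction zero    σ t = false
    correction (suc j) σ t =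
      ⨁ points (λ v → maybe′ (λ τ → fill (centre-of j τ) (cocycle j τ) t) false (insert v σ))

    -- The coboundary of the pullback is the sum of the pullbacks of the enlarged simplices `τ`,
    -- that of the correction is the sum of their cocycles. Together they leave the corrections of
    -- the `τ`, a sum over ordered pairs of added vertices that cancels by symmetry.
    cocycle-closed : ∀ j σ → holes σ ≤ j → Rainbow σ → ∀ {t} → Clique t → δ (cocycle j σ) t ≡ false
    cocycle-closed j σ h rb {t} ct
      rewrite ext-xor (const true) (pullback σ) (correction j σ) t
            | δ-pullback σ rb ct = go j h
      where
      go : ∀ j → holes σ ≤ j →
        ⨁ points (λ v → maybe′ (λ τ → pullback τ t) false (insert v σ)) xor δ (correction j σ) t ≡ false
      go zero h = cong₂ _xor_ (⨁-false points full) (ext-false (const true) t)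
        where
        full : ∀ v → maybe′ (λ τ → pullback τ t) false (insert v σ) ≡ false
        full v with insert v σ in eq
        ... | nothing = refl
        ... | just τ with subst (_≤ 0) (insert-holes v σ eq) h
        ...   | ()
      go (suc j) h = begin
        P xor δ (correction (suc j) σ) t
          ≡⟨ cong (P xor_) (ext-⨁ (const true) points _ t) ⟩
        P xor ⨁ points (λ v → δ (λ s → maybe′ (λ τ → fill (centre-of j τ) (cocycle j τ) s) false (insert v σ)) t)
          ≡⟨ cong (P xor_) (⨁-cong points filled) ⟩
        P xor ⨁ points (λ v → maybe′ (λ τ → cocycle j τ t) false (insert v σ))
          ≡⟨ sym (⨁-xor points _ _) ⟩
        ⨁ points (λ v → maybe′ (λ τ → pullback τ t) false (insert v σ)
                        xor maybe′ (λ τ → cocycle j τ t) false (insert v σ))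
          ≡⟨ ⨁-cong points cancel ⟩
        ⨁ points (λ v → maybe′ (λ τ → correction j τ t) false (insert v σ))
          ≡⟨ corrections j ⟩
        false ∎
        where
        open ≡-Reasoning
        P = ⨁ points (λ v → maybe′ (λ τ → pullback τ t) false (insert v σ))

        filled : ∀ v →
          δ (λ s → maybe′ (λ τ → fill (centre-of j τ) (cocycle j τ) s) false (insert v σ)) t
          ≡ maybe′ (λ τ → cocycle j τ t) false (insert v σ)
        filled v with insert v σ in eq
        ... | nothing = ext-false (const true) t
        ... | just τ  = fill-closed (centre-of j τ) (cocycle j τ)
                          (cocycle-closed j τ (≤-pred (subst (_≤ suc j) (insert-holes v σ eq) h))
                                              (insert-rainbow v σ eq rb)) ct

        cancel : ∀ v → maybe′ (λ τ → pullback τ t) false (insert v σ)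
                         xor maybe′ (λ τ → cocycle j τ t) false (insert v σ)
                     ≡ maybe′ (λ τ → correction j τ t) false (insert v σ)
        cancel v with insert v σ
        ... | nothing = refl
        ... | just τ  = solve 2 (λ a b → a :+ (a :+ b) := b) refl (pullback τ t) (correction j τ t)
          where open xor-∧-Solver

        corrections : ∀ j → ⨁ points (λ v → maybe′ (λ τ → correction j τ t) false (insert v σ)) ≡ false
        corrections zero = ⨁-false points none
          where
          none : ∀ v → maybe′ (λ τ → false) false (insert v σ) ≡ false
          none v with insert v σ
          ... | nothing = refl
          ... | just _  = refl
        corrections (suc j) = trans (⨁-cong points double)
          (⨁-symmetric points (insert² f σ) (insert²-sym f σ) (λ v → insert²-same-colour f σ v v refl))
          where
          f : Simplex k → Bool
          f ρ = fill (centre-of j ρ) (cocycle j ρ) t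
          double : ∀ v → maybe′ (λ τ → correction (suc j) τ t) false (insert v σ)
                       ≡ ⨁ points (insert² f σ v)
          double v with insert v σ
          ... | nothing = sym (⨁-false points (λ _ → refl))
          ... | just _  = refl

    meets-true : ∀ v {x y} → x ~ y → class v y ≡ true → meets v x ≡ true
    meets-true v {x} {y} x~y e =
      any-true (λ y → does (x ~? y) ∧ class v y) (complete y)
               (trans (cong (_∧ class v y) (true-does (x ~? y) x~y)) e)

    -- Each class in `σ` has a point among the entries of `t`, and `x` is adjacent to that point
    -- without having to lie in the class. This is why `near` asks for adjacency.
    pullback-near : ∀ {j} (σ : Simplex j) x t → All (x ~_) t → pullback σ t ≡ true → near σ x ≡ true
    pullback-near []            x t x~t e = refl
    pullback-near (nothing ∷ σ) x t x~t e = pullback-near σ x t x~t e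
    pullback-near (just v ∷ σ)  x t x~t e with ext-true (class v) (pullback σ) t e x~t
    ... | y , s , x~y , cy , x~s , es rewrite meets-true v x~y cy = pullback-near σ x s x~s es

    -- A nonzero correction comes from a filling over some `τ`. Its vertices are traced back to a
    -- clique on which `cocycle j τ` is nonzero, and by induction this clique lies in `support j τ`.
    cocycle-support : ∀ j σ {t} → Clique t → cocycle j σ t ≡ true →
      ∀ {x} → x ∈ t → support j σ x ≡ true
    cocycle-support j σ {t} ct e {x} x∈ with xor-true (pullback σ t) _ e
    ... | inj₁ e₁ rewrite pullback-near σ x t (All.tabulate (clique-∈ ct x∈)) e₁ = refl
    cocycle-support (suc j) σ {t} ct e {x} x∈ | inj₂ e₂
      with ⨁-true points (λ v → maybe′ (λ τ → fill (centre-of j τ) (cocycle j τ) t) false (insert v σ)) e₂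
    ... | v , ev = ∨-trueʳ (near σ x) _ (any-true _ (complete v) (shadowed ev))
      where
      shadowed : maybe′ (λ τ → fill (centre-of j τ) (cocycle j τ) t) false (insert v σ) ≡ true →
        maybe′ (λ τ → shadow (centre-of j τ) (support j τ) x) false (insert v σ) ≡ true
      shadowed ev with insert v σ
      ... | just τ with fill-true (centre-of j τ) (cocycle j τ) ct ev
      ...   | s , cs , zs , tr with tr x∈
      ...     | q , q∈s , q∈tr = any-true (support j τ) q∈tr (cocycle-support j τ cs zs q∈s)

    -- Sizes of supports by double counting.

    ∑-meets : ∀ x → ∑ points (λ v → ⟦ meets v x ⟧) ≤ degree
    ∑-meets x = begin
      ∑ points (λ v → ⟦ meets v x ⟧)
        ≤⟨ ∑-mono points (λ v → any≤∑ _ points) ⟩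
      ∑ points (λ v → ∑ points (λ y → ⟦ does (x ~? y) ∧ class v y ⟧))
        ≡⟨ ∑-swap points points _ ⟩
      ∑ points (λ y → ∑ points (λ v → ⟦ does (x ~? y) ∧ class v y ⟧))
        -- A neighbour `y` of `x` belongs to one class only.
        ≤⟨ ∑-mono points one ⟩
      ∑ points (λ y → ⟦ does (x ~? y) ⟧)
        ≤⟨ degree-bound x ⟩
      degree ∎
      where
      open ≤-Reasoning
      one : ∀ y → ∑ points (λ v → ⟦ does (x ~? y) ∧ class v y ⟧) ≤ ⟦ does (x ~? y) ⟧
      one y with does (x ~? y)
      ... | true  = ∑-indicator _≟_ (label y) unique
      ... | false = ≤-reflexive (trans (∑-const points 0) (*-zeroʳ (length points)))

    size-meets : ∀ v → size (meets v) ≤ degree * size (class v)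
    size-meets v = begin
      size (meets v)
        ≤⟨ ∑-mono points (λ x → any≤∑ _ points) ⟩
      ∑ points (λ x → ∑ points (λ y → ⟦ does (x ~? y) ∧ class v y ⟧))
        ≡⟨ ∑-swap points points _ ⟩
      ∑ points (λ y → ∑ points (λ x → ⟦ does (x ~? y) ∧ class v y ⟧))
        ≤⟨ ∑-mono points one ⟩
      ∑ points (λ y → degree * ⟦ class v y ⟧)
        ≡⟨ ∑-* points degree _ ⟩
      degree * size (class v) ∎
      where
      open ≤-Reasoning
      flip≤ : ∀ x y → ⟦ does (x ~? y) ∧ true ⟧ ≤ ⟦ does (y ~? x) ⟧
      flip≤ x y with x ~? y
      ... | no _    = z≤n
      ... | yes x~y rewrite true-does (y ~? x) (~-sym x~y) = ≤-refl
      none : ∀ x y → ⟦ does (x ~? y) ∧ false ⟧ ≡ 0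
      none x y rewrite ∧-zeroʳ (does (x ~? y)) = refl
      one : ∀ y → ∑ points (λ x → ⟦ does (x ~? y) ∧ class v y ⟧) ≤ degree * ⟦ class v y ⟧
      one y with class v y
      ... | true  = ≤-trans (∑-mono points (λ x → flip≤ x y))
                            (≤-trans (degree-bound y) (≤-reflexive (sym (*-identityʳ degree))))
      ... | false = ≤-trans (≤-reflexive (trans (∑-cong points (λ x → none x y))
                                                (trans (∑-const points 0) (*-zeroʳ (length points)))))
                            z≤n

    near-update : ∀ {j} (σ : Simplex j) c v x →
      near (σ [ c ]≔ just v) x ≡ meets v x ∧ near (σ [ c ]≔ nothing) x
    near-update (_ ∷ σ)       zero    v x = refl
    near-update (nothing ∷ σ) (suc c) v x = near-update σ c v x
    near-update (just w ∷ σ)  (suc c) v x rewrite near-update σ c v x =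
      solve 3 (λ a b c → a :* (b :* c) := b :* (a :* c)) refl
        (meets w x) (meets v x) (near (σ [ c ]≔ nothing) x)
      where open xor-∧-Solver

    insert-near : ∀ v σ {τ} → insert v σ ≡ just τ → ∀ x → near τ x ≡ meets v x ∧ near σ x
    insert-near v σ e x with lookup σ (colour v) in eq
    insert-near v σ refl x | nothing =
      trans (near-update σ (colour v) v x)
            (cong (λ τ → meets v x ∧ near τ x) (update-≡ σ (colour v) eq))

    -- Summing over all added vertices costs only the factor `degree`, however many components there
    -- are, because a point near `σ` is close to at most `degree` classes.
    size-support : ∀ j σ → size (support j σ) ≤ growth j * size (near σ)
    size-support zero    σ = ≤-reflexive (trans
      (∑-cong points (λ x → cong ⟦_⟧ (∨-identityʳ (near σ x)))) (sym (*-identityˡ _)))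
    size-support (suc j) σ = begin
      size (support (suc j) σ)
        ≤⟨ ∑-mono points (λ x → ⟦∨⟧≤ (near σ x) _) ⟩
      ∑ points (λ x → ⟦ near σ x ⟧ + ⟦ extra (suc j) σ x ⟧)
        ≡⟨ ∑-+ points _ _ ⟩
      size (near σ) + size (extra (suc j) σ)
        ≤⟨ +-monoʳ-≤ (size (near σ)) size-extra ⟩
      size (near σ) + dilation * growth j * degree * size (near σ) ∎
      where
      open ≤-Reasoning
      Shadow : V → V → Bool
      Shadow v x = maybe′ (λ τ → shadow (centre-of j τ) (support j τ) x) false (insert v σ)

      size-shadow : ∀ v → size (Shadow v) ≤ dilation * growth j * size (λ x → meets v x ∧ near σ x)
      size-shadow v with insert v σ in eq
      ... | nothing = ≤-trans (≤-reflexive (trans (∑-const points 0) (*-zeroʳ (length points)))) z≤n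
      ... | just τ  = begin
        size (shadow (centre-of j τ) (support j τ))
          ≤⟨ proj₁ (proj₂ (centre (support j τ))) ⟩
        dilation * size (support j τ)
          ≤⟨ *-monoʳ-≤ dilation (size-support j τ) ⟩
        dilation * (growth j * size (near τ))
          ≡⟨ sym (*-assoc dilation (growth j) _) ⟩
        dilation * growth j * size (near τ)
          ≡⟨ cong (dilation * growth j *_) (∑-cong points (λ x → cong ⟦_⟧ (insert-near v σ eq x))) ⟩
        dilation * growth j * size (λ x → meets v x ∧ near σ x) ∎

      meets-near : ∀ x → ∑ points (λ v → ⟦ meets v x ∧ near σ x ⟧) ≤ degree * ⟦ near σ x ⟧
      meets-near x with near σ x
      ... | true  = begin
        ∑ points (λ v → ⟦ meets v x ∧ true ⟧)
          ≡⟨ ∑-cong points (λ v → cong ⟦_⟧ (∧-identityʳ (meets v x))) ⟩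
        ∑ points (λ v → ⟦ meets v x ⟧)
          ≤⟨ ∑-meets x ⟩
        degree
          ≡⟨ sym (*-identityʳ degree) ⟩
        degree * 1 ∎
      ... | false = begin
        ∑ points (λ v → ⟦ meets v x ∧ false ⟧)
          ≡⟨ ∑-cong points (λ v → cong ⟦_⟧ (∧-zeroʳ (meets v x))) ⟩
        ∑ points (λ v → 0)
          ≡⟨ trans (∑-const points 0) (*-zeroʳ (length points)) ⟩
        0
          ≤⟨ z≤n ⟩
        degree * 0 ∎

      size-extra : size (extra (suc j) σ) ≤ dilation * growth j * degree * size (near σ)
      size-extra = begin
        size (extra (suc j) σ)
          ≤⟨ ∑-mono points (λ x → any≤∑ (λ v → Shadow v x) points) ⟩
        ∑ points (λ x → ∑ points (λ v → ⟦ Shadow v x ⟧))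
          ≡⟨ ∑-swap points points _ ⟩
        ∑ points (λ v → size (Shadow v))
          ≤⟨ ∑-mono points size-shadow ⟩
        ∑ points (λ v → dilation * growth j * size (λ x → meets v x ∧ near σ x))
          ≡⟨ ∑-* points (dilation * growth j) _ ⟩
        dilation * growth j * ∑ points (λ v → size (λ x → meets v x ∧ near σ x))
          ≡⟨ cong (dilation * growth j *_) (∑-swap points points _) ⟩
        dilation * growth j * ∑ points (λ x → ∑ points (λ v → ⟦ meets v x ∧ near σ x ⟧))
          ≤⟨ *-monoʳ-≤ (dilation * growth j) (∑-mono points meets-near) ⟩
        dilation * growth j * ∑ points (λ x → degree * ⟦ near σ x ⟧)
          ≡⟨ cong (dilation * growth j *_) (∑-* points degree _) ⟩
        dilation * growth j * (degree * size (near σ))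
          ≡⟨ sym (*-assoc (dilation * growth j) degree _) ⟩
        dilation * growth j * degree * size (near σ) ∎

    -- The empty simplex and the large class.

    empty : ∀ j → Simplex j
    empty j = replicate j nothing

    holes-empty : ∀ j → holes (empty j) ≡ j
    holes-empty zero    = refl
    holes-empty (suc j) = cong suc (holes-empty j)

    pullback-empty : ∀ j → pullback (empty j) [] ≡ true
    pullback-empty zero    = refl
    pullback-empty (suc j) = pullback-empty j

    near-empty : ∀ j x → near (empty j) x ≡ true
    near-empty zero    x = refl
    near-empty (suc j) x = near-empty j x

    rainbow-empty : Rainbow (empty k)
    rainbow-empty c e with trans (sym e) (lookup-replicate c nothing)
    ... | ()

    -- Closedness on a one-point sequence says that the cocycle of the empty simplex vanishes on the
    -- empty sequence. The pullback is `true` there, so the correction must be `true` too.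
    correction-empty : ∀ {j} → k ≡ suc j → V → correction (suc j) (empty k) [] ≡ true
    correction-empty {j} refl x =
      xor-false (pullback (empty k) []) (correction (suc j) (empty k) []) (pullback-empty k)
        (trans (sym (xor-identityʳ (cocycle (suc j) (empty k) [])))
               (cocycle-closed (suc j) (empty k) (≤-reflexive (holes-empty k)) rainbow-empty {x ∷ []} ([] ∷ [])))
      where
      xor-false : ∀ a b → a ≡ true → a xor b ≡ false → b ≡ true
      xor-false true true refl _ = refl

    -- By `fill-[]` the hypothesis puts the centre inside `support j τ`, where the second property
    -- of `centre` bounds the number of all points. As every point is near `σ`, being near `τ`
    -- amounts to being close to the class of `v`.
    fill-bound : ∀ j v σ → (∀ x → near σ x ≡ true) →
      maybe′ (λ τ → fill (centre-of j τ) (cocycle j τ) []) false (insert v σ) ≡ true →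
      length points ≤ capacity * (growth j * (degree * size (class v)))
    fill-bound j v σ all-near e with insert v σ in eq
    ... | just τ = begin
      length points
        ≤⟨ proj₂ (proj₂ (centre (support j τ)))
             (cocycle-support j τ ([] ∷ []) (trans (sym (fill-[] (centre-of j τ) (cocycle j τ))) e) (here refl)) ⟩
      capacity * size (support j τ)
        ≤⟨ *-monoʳ-≤ capacity (size-support j τ) ⟩
      capacity * (growth j * size (near τ))
        ≡⟨ cong (λ s → capacity * (growth j * s)) (∑-cong points near-τ) ⟩
      capacity * (growth j * size (meets v))
        ≤⟨ *-monoʳ-≤ capacity (*-monoʳ-≤ (growth j) (size-meets v)) ⟩
      capacity * (growth j * (degree * size (class v))) ∎
      where
      open ≤-Reasoning
      near-τ : ∀ x → ⟦ near τ x ⟧ ≡ ⟦ meets v x ⟧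
      near-τ x = cong ⟦_⟧ (trans (insert-near v σ eq x)
                  (trans (cong (meets v x ∧_) (all-near x)) (∧-identityʳ (meets v x))))

    large-class : ∀ {j} → k ≡ suc j → V →
      ∃ λ v → length points ≤ capacity * (growth j * (degree * size (class v)))
    large-class {j} k≡1+j x =
      let v , e = ⨁-true points
            (λ v → maybe′ (λ τ → fill (centre-of j τ) (cocycle j τ) []) false (insert v (empty k)))
            (correction-empty k≡1+j x)
      in v , fill-bound j v (empty k) (near-empty k) e

-- Components of a finite graph by merging along edges.

module Components where

  open import Data.Bool using (if_then_else_)
  open import Data.List using (List; []; _∷_; filter; cartesianProduct)
  open import Data.List.Membership.Propositional using (_∈_)
  open import Data.List.Membership.Propositional.Properties using (∈-filter⁺; ∈-cartesianProduct⁺)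
  open import Data.List.Relation.Unary.All using (All; []; _∷_)
  open import Data.List.Relation.Unary.All.Properties using (all-filter)
  open import Data.List.Relation.Unary.Any using (here; there)
  open import Data.Product using (∃; _×_; _,_; uncurry)
  open import Relation.Binary.Construct.Closure.ReflexiveTransitive using (Star; ε; _◅_; _◅◅_; reverse)
  open import Relation.Binary.Definitions using (Symmetric; Decidable; DecidableEquality)
  open import Relation.Binary.PropositionalEquality
  open import Relation.Nullary using (does; yes; no; contradiction)

  module _ {V : Set} (_≟_ : DecidableEquality V) {R : V → V → Set} (R-sym : Symmetric R) where

    -- Union-find as a function: each edge redirects the points represented like `a` to the
    -- representative of `b`.
    merge : List (V × V) → V → V
    merge []             x = x
    merge ((a , b) ∷ es) x =
      if does (merge es x ≟ merge es a) then merge es b else merge es x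

    merge-connected : ∀ {es} → All (uncurry R) es → ∀ x → Star R x (merge es x)
    merge-connected [] x = ε
    merge-connected {(a , b) ∷ es} (r ∷ rs) x with merge es x ≟ merge es a
    ... | no _  = merge-connected rs x
    ... | yes e = subst (Star R x) e (merge-connected rs x)
                  ◅◅ reverse R-sym (merge-connected rs a) ◅◅ r ◅ merge-connected rs b

    merge-≡ : ∀ {a b es} → (a , b) ∈ es → merge es a ≡ merge es b
    merge-≡ {a} {b} {_ ∷ es} (here refl) with merge es a ≟ merge es a | merge es b ≟ merge es a
    ... | no ¬e | _     = contradiction refl ¬e
    ... | yes _ | yes _ = refl
    ... | yes _ | no _  = refl
    merge-≡ {es = (c , d) ∷ es} (there e∈) =
      cong (λ y → if does (y ≟ merge es c) then merge es d else y) (merge-≡ e∈)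

    components : Decidable R → ∀ {xs} → (∀ x → x ∈ xs) →
      ∃ λ (f : V → V) → (∀ x → Star R x (f x)) × (∀ {x y} → R x y → f x ≡ f y)
    components _R?_ {xs} complete =
      merge edges , merge-connected (all-filter R?₂ pairs) ,
      λ {x} {y} r → merge-≡ (∈-filter⁺ R?₂ (∈-cartesianProduct⁺ (complete x) (complete y)) r)
      where
      R?₂ : (e : V × V) → _
      R?₂ (a , b) = a R? b
      pairs = cartesianProduct xs xs
      edges = filter R?₂ pairs

-- The grid: contraction, counting and the choice of centres.

module Grids where

  open FiniteSums
  open Contractions
  open Waists
  open import Data.Bool using (Bool; true)
  open import Data.Bool.ListAction using (any)
  open import Data.Fin using (Fin; zero; suc; toℕ)
  import Data.Fin.Properties as Fin
  open import Data.List using (List; []; _∷_; _++_; map; length; allFin; cartesianProductWith)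
  open import Data.List.Properties using (length-tabulate)
  open import Data.List.Membership.Propositional using (_∈_)
  open import Data.List.Membership.Propositional.Properties
    using (∈-map⁺; ∈-++⁺ˡ; ∈-++⁺ʳ; ∈-allFin; ∈-cartesianProductWith⁺)
  open import Data.List.Relation.Unary.Any using (here)
  open import Data.List.Relation.Unary.All using ([])
  open import Data.List.Relation.Unary.AllPairs using ([]; _∷_)
  open import Data.List.Relation.Unary.Unique.Propositional using (Unique)
  import Data.List.Relation.Unary.Unique.Propositional.Properties as Unique
  open import Data.Nat using (ℕ; zero; suc; pred; _+_; _*_; _^_; _⊓_; _≤_; z≤n; s≤s; _≤?_)
  import Data.Nat as ℕ
  open import Data.Nat.Properties
  open import Data.Nat.Solver using (module +-*-Solver)
  open import Data.Product using (∃; _×_; _,_)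
  open import Data.Vec using (Vec; []; _∷_)
  import Data.Vec.Properties as Vec
  open import Data.Vec.Relation.Binary.Pointwise.Inductive using (Pointwise; []; _∷_)
  import Data.Vec.Relation.Binary.Pointwise.Inductive as Pointwise
  open import Function using (_∘_; id; const)
  open import Relation.Binary.Construct.Closure.ReflexiveTransitive using (Star; ε; _◅_; _◅◅_; gmap)
  open import Relation.Binary.Definitions using (Decidable)
  open import Relation.Binary.PropositionalEquality hiding ([_])
  open import Relation.Nullary using (Dec; does; yes; no; contradiction)
  open import Relation.Nullary.Decidable using (_×-dec_)

  -- Two inequalities in place of an absolute difference, so that monotonicity of `⊓` applies to
  -- clamped coordinates directly.
  Near : ∀ {n} → Fin n → Fin n → Set
  Near a b = toℕ a ≤ suc (toℕ b) × toℕ b ≤ suc (toℕ a)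

  near-refl : ∀ {n} {a : Fin n} → Near a a
  near-refl = n≤1+n _ , n≤1+n _

  near-sym : ∀ {n} {a b : Fin n} → Near a b → Near b a
  near-sym (p , q) = q , p

  near? : ∀ {n} → Decidable (Near {n})
  near? a b = (toℕ a ≤? suc (toℕ b)) ×-dec (toℕ b ≤? suc (toℕ a))

  does-bound : ∀ {P : Set} {m} (P? : Dec P) → (P → 1 ≤ m) → ⟦ does P? ⟧ ≤ m
  does-bound (no _)  f = z≤n
  does-bound (yes p) f = f p

  ∑-near : ∀ {n} (a : Fin n) → ∑ (allFin n) (λ b → ⟦ does (near? a b) ⟧) ≤ 3
  ∑-near {n} a = begin
    ∑ (allFin n) (λ b → ⟦ does (near? a b) ⟧)
      ≤⟨ ∑-mono (allFin n) covered ⟩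
    -- For `k = 0` the value `pred k` repeats `k`, which only enlarges the upper bound.
    ∑ (allFin n) (λ b → at (pred k) b + (at k b + at (suc k) b))
      ≡⟨ trans (∑-+ (allFin n) _ _) (cong (∑ (allFin n) (at (pred k)) +_) (∑-+ (allFin n) _ _)) ⟩
    ∑ (allFin n) (at (pred k)) + (∑ (allFin n) (at k) + ∑ (allFin n) (at (suc k)))
      ≤⟨ +-mono-≤ (∑-at (pred k)) (+-mono-≤ (∑-at k) (∑-at (suc k))) ⟩
    3 ∎
    where
    open ≤-Reasoning
    k = toℕ a
    at : ℕ → Fin n → ℕ
    at i b = ⟦ does (i ℕ.≟ toℕ b) ⟧
    ∑-at : ∀ i → ∑ (allFin n) (at i) ≤ 1
    ∑-at i = subst (_≤ 1) (∑-map toℕ (allFin n) _)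
      (∑-indicator ℕ._≟_ i (Unique.map⁺ Fin.toℕ-injective (Unique.allFin⁺ n)))
    at-≡ : ∀ {i b} → i ≡ toℕ b → 1 ≤ at i b
    at-≡ {i} {b} e rewrite true-does (i ℕ.≟ toℕ b) e = ≤-refl
    covered-near : ∀ b → Near a b → 1 ≤ at (pred k) b + (at k b + at (suc k) b)
    covered-near b (p , q) with k ℕ.≟ toℕ b
    ... | yes e = ≤-trans (≤-trans (at-≡ e) (m≤m+n _ _)) (m≤n+m _ (at (pred k) b))
    ... | no k≢b with suc k ℕ.≟ toℕ b
    ...   | yes e = ≤-trans (≤-trans (at-≡ e) (m≤n+m _ (at k b))) (m≤n+m _ (at (pred k) b))
    ...   | no 1+k≢b = ≤-trans (at-≡ (cong pred (≤-antisym p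
                         (≤∧≢⇒< (≤-pred (≤∧≢⇒< q (1+k≢b ∘ sym))) (k≢b ∘ sym))))) (m≤m+n _ _)
    covered : ∀ b → ⟦ does (near? a b) ⟧ ≤ at (pred k) b + (at k b + at (suc k) b)
    covered b = does-bound (near? a b) (covered-near b)

  -- A move of a single coordinate. It records no trace, since the traces in the grid contain whole
  -- lines.
  record Glide {n} (g h : Fin n → Fin n) : Set where
    field
      source : ∀ {x y} → Near x y → Near (g x) (g y)
      target : ∀ {x y} → Near x y → Near (h x) (h y)
      across : ∀ {x y} → Near x y → Near (g x) (h y)

  -- Moving all points by one step at once would separate x from the image of its neighbour; lowering
  -- a ceiling moves only the points at the top.
  clamp : ∀ {n} → ℕ → Fin n → Fin n
  clamp _       zero    = zero
  clamp zero    (suc _) = zero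
  clamp (suc t) (suc x) = suc (clamp t x)

  toℕ-clamp : ∀ {n} t (x : Fin n) → toℕ (clamp t x) ≡ toℕ x ⊓ t
  toℕ-clamp t       zero    = refl
  toℕ-clamp zero    (suc x) = refl
  toℕ-clamp (suc t) (suc x) = cong suc (toℕ-clamp t x)

  clamp-near : ∀ {n} {s t} → s ≤ suc t → t ≤ suc s → {x y : Fin n} →
    Near x y → Near (clamp s x) (clamp t y)
  clamp-near {s = s} {t} s≤ t≤ {x} {y} (p , q)
    rewrite toℕ-clamp s x | toℕ-clamp t y = ⊓-mono-≤ p s≤ , ⊓-mono-≤ q t≤

  clamp-glide : ∀ {n} {s t} → s ≤ suc t → t ≤ suc s → Glide {n} (clamp s) (clamp t)
  clamp-glide s≤ t≤ = record
    { source = clamp-near (n≤1+n _) (n≤1+n _)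
    ; target = clamp-near (n≤1+n _) (n≤1+n _)
    ; across = clamp-near s≤ t≤ }

  clamp-to-zero : ∀ {n} t → Star (Glide {n}) (clamp t) (clamp 0)
  clamp-to-zero zero    = ε
  clamp-to-zero (suc t) = clamp-glide ≤-refl (≤-trans (n≤1+n t) (n≤1+n _)) ◅ clamp-to-zero t

  clamp-large : ∀ {n} (x : Fin n) → clamp n x ≡ x
  clamp-large zero    = refl
  clamp-large (suc x) = cong suc (clamp-large x)

  path-from-zero : ∀ {n} (p : Fin (suc n)) → Star Near zero p
  path-from-zero         zero    = ε
  path-from-zero {suc n} (suc p) = (z≤n , ≤-refl) ◅ gmap suc (λ (q , r) → s≤s q , s≤s r) (path-from-zero p)

  const-glide : ∀ {n} {a b : Fin n} → Near a b → Glide (const a) (const b)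
  const-glide {a = a} {b} r = record { source = λ _ → near-refl {a = a} ; target = λ _ → near-refl {a = b} ; across = λ _ → r }

  clamp-zero : ∀ {n} (x : Fin (suc n)) → clamp 0 x ≡ zero
  clamp-zero zero    = refl
  clamp-zero (suc x) = refl

  -- The ceiling is lowered to 0, then the constant map walks from 0 to `p`. The two moves written
  -- out switch between pointwise equal maps: `id` and `clamp (suc n)`, then `clamp 0` and the
  -- constant map at 0.
  line-contract : ∀ {n} (p : Fin (suc n)) → Star Glide id (const p)
  line-contract {n} p =
    record { source = id ; target = clamp-near (n≤1+n _) (n≤1+n _) ; across = id-clamp }
    ◅ clamp-to-zero (suc n)
    ◅◅ record { source = clamp-near (n≤1+n _) (n≤1+n _) ; target = λ _ → near-refl {a = zero {n}} ; across = clamp-const }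
    ◅ gmap const const-glide (path-from-zero p)
    where
    id-clamp : ∀ {x y : Fin (suc n)} → Near x y → Near x (clamp (suc n) y)
    id-clamp {x} {y} r rewrite clamp-large y = r
    clamp-const : ∀ {x y : Fin (suc n)} → Near x y → Near (clamp 0 x) (zero {n})
    clamp-const {x} _ rewrite clamp-zero x = near-refl {a = zero {n}}

  module _ {n : ℕ} where

    Adj : ∀ {d} → Vec (Fin n) d → Vec (Fin n) d → Set
    Adj = Pointwise Near

    adj-refl : ∀ {d} {x : Vec (Fin n) d} → Adj x x
    adj-refl = Pointwise.refl near-refl

    adj-sym : ∀ {d} {x y : Vec (Fin n) d} → Adj x y → Adj y x
    adj-sym = Pointwise.sym near-sym

    adj? : ∀ {d} → Decidable (Adj {d})
    adj? = Pointwise.decidable near?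

    grid : ∀ d → List (Vec (Fin n) d)
    grid zero    = [] ∷ []
    grid (suc d) = cartesianProductWith _∷_ (allFin n) (grid d)

    grid-unique : ∀ d → Unique (grid d)
    grid-unique zero    = [] ∷ []
    grid-unique (suc d) =
      Unique.cartesianProductWith⁺ _∷_ Vec.∷-injective (Unique.allFin⁺ n) (grid-unique d)

    grid-complete : ∀ {d} (x : Vec (Fin n) d) → x ∈ grid d
    grid-complete []      = here refl
    grid-complete (a ∷ x) = ∈-cartesianProductWith⁺ _∷_ (∈-allFin a) (grid-complete x)

    length-allFin : length (allFin n) ≡ n
    length-allFin = length-tabulate id

    ∑-grid : ∀ d f → ∑ (grid (suc d)) f ≡ ∑ (allFin n) (λ a → ∑ (grid d) (λ x → f (a ∷ x)))
    ∑-grid d f = ∑-product _∷_ (allFin n) (grid d) f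

    length-grid : ∀ d → length (grid d) ≡ n ^ d
    length-grid zero    = refl
    length-grid (suc d) = begin
      length (grid (suc d))                           ≡⟨ sym (*-identityʳ _) ⟩
      length (grid (suc d)) * 1                       ≡⟨ sym (∑-const (grid (suc d)) 1) ⟩
      ∑ (grid (suc d)) (const 1)                      ≡⟨ ∑-grid d (const 1) ⟩
      ∑ (allFin n) (λ _ → ∑ (grid d) (const 1))       ≡⟨ ∑-const (allFin n) _ ⟩
      length (allFin n) * ∑ (grid d) (const 1)
        ≡⟨ cong₂ _*_ length-allFin (trans (∑-const (grid d) 1) (trans (*-identityʳ _) (length-grid d))) ⟩
      n * n ^ d ∎
      where open ≡-Reasoning

    grid-degree : ∀ {d} (x : Vec (Fin n) d) → ∑ (grid d) (λ y → ⟦ does (adj? x y) ⟧) ≤ 3 ^ d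
    grid-degree []      = ≤-refl
    grid-degree {suc d} (a ∷ x) = begin
      ∑ (grid (suc d)) (λ y → ⟦ does (adj? (a ∷ x) y) ⟧)
        ≡⟨ ∑-grid d _ ⟩
      ∑ (allFin n) (λ b → ∑ (grid d) (λ y → ⟦ does (adj? (a ∷ x) (b ∷ y)) ⟧))
        ≤⟨ ∑-mono (allFin n) (λ b → ∑-mono (grid d) (λ y → split b y)) ⟩
      ∑ (allFin n) (λ b → ∑ (grid d) (λ y → ⟦ does (near? a b) ⟧ * ⟦ does (adj? x y) ⟧))
        ≡⟨ ∑-cong (allFin n) (λ b → ∑-* (grid d) ⟦ does (near? a b) ⟧ _) ⟩
      ∑ (allFin n) (λ b → ⟦ does (near? a b) ⟧ * s)
        ≡⟨ ∑-cong (allFin n) (λ b → *-comm ⟦ does (near? a b) ⟧ s) ⟩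
      ∑ (allFin n) (λ b → s * ⟦ does (near? a b) ⟧)
        ≡⟨ ∑-* (allFin n) s _ ⟩
      s * ∑ (allFin n) (λ b → ⟦ does (near? a b) ⟧)
        ≤⟨ *-mono-≤ (grid-degree x) (∑-near a) ⟩
      3 ^ d * 3
        ≡⟨ *-comm (3 ^ d) 3 ⟩
      3 * 3 ^ d ∎
      where
      open ≤-Reasoning
      s = ∑ (grid d) (λ y → ⟦ does (adj? x y) ⟧)
      split : ∀ b y → ⟦ does (adj? (a ∷ x) (b ∷ y)) ⟧ ≤ ⟦ does (near? a b) ⟧ * ⟦ does (adj? x y) ⟧
      split b y = does-bound (adj? (a ∷ x) (b ∷ y)) both
        where
        both : Adj (a ∷ x) (b ∷ y) → 1 ≤ ⟦ does (near? a b) ⟧ * ⟦ does (adj? x y) ⟧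
        both (p ∷ q) rewrite true-does (near? a b) p | true-does (adj? x y) q = ≤-refl

    -- Contains the path from x to p that corrects the coordinates in order. Whole lines are taken in
    -- place of segments because the contraction of a line to p passes through 0.
    trace : ∀ {d} → Vec (Fin n) d → Vec (Fin n) d → List (Vec (Fin n) d)
    trace []      []      = [] ∷ []
    trace (p ∷ q) (a ∷ x) = map (_∷ x) (allFin n) ++ map (p ∷_) (trace q x)

    head∈trace : ∀ {d} p (q : Vec (Fin n) d) a b x → b ∷ x ∈ trace (p ∷ q) (a ∷ x)
    head∈trace p q a b x = ∈-++⁺ˡ (∈-map⁺ (_∷ x) (∈-allFin b))

    tail∈trace : ∀ {d} p (q : Vec (Fin n) d) a {x y} → y ∈ trace q x → p ∷ y ∈ trace (p ∷ q) (a ∷ x)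
    tail∈trace p q a {x} y∈ = ∈-++⁺ʳ (map (_∷ x) (allFin n)) (∈-map⁺ (p ∷_) y∈)

    start∈trace : ∀ {d} (p x : Vec (Fin n) d) → x ∈ trace p x
    start∈trace []      []      = here refl
    start∈trace (p ∷ q) (a ∷ x) = head∈trace p q a a x

    end∈trace : ∀ {d} (p x : Vec (Fin n) d) → p ∈ trace p x
    end∈trace []      []      = here refl
    end∈trace (p ∷ q) (a ∷ x) = tail∈trace p q a (end∈trace q x)

    onHead : (Fin n → Fin n) → ∀ {d} → Vec (Fin n) (suc d) → Vec (Fin n) (suc d)
    onHead g (a ∷ x) = g a ∷ x

    onTail : Fin n → ∀ {d} → (Vec (Fin n) d → Vec (Fin n) d) → Vec (Fin n) (suc d) → Vec (Fin n) (suc d)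
    onTail p g (a ∷ x) = p ∷ g x

    GridMove : ∀ {d} → Vec (Fin n) d → (g h : Vec (Fin n) d → Vec (Fin n) d) → Set
    GridMove p = Move Adj (trace p)

    head-move : ∀ {d} p (q : Vec (Fin n) d) {g h} → Glide g h → GridMove (p ∷ q) (onHead g) (onHead h)
    head-move p q {g} {h} m = record
      { source  = λ { (r ∷ rs) → G.source r ∷ rs }
      ; target  = λ { (r ∷ rs) → G.target r ∷ rs }
      ; across  = λ { (r ∷ rs) → G.across r ∷ rs }
      ; g∈trace = λ { (a ∷ x) → head∈trace p q a (g a) x }
      ; h∈trace = λ { (a ∷ x) → head∈trace p q a (h a) x } }
      where module G = Glide m

    tail-move : ∀ {d} p (q : Vec (Fin n) d) {g h} → GridMove q g h → GridMove (p ∷ q) (onTail p g) (onTail p h)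
    tail-move p q m = record
      { source  = λ { (r ∷ rs) → near-refl ∷ M.source rs }
      ; target  = λ { (r ∷ rs) → near-refl ∷ M.target rs }
      ; across  = λ { (r ∷ rs) → near-refl ∷ M.across rs }
      ; g∈trace = λ { (a ∷ x) → tail∈trace p q a (M.g∈trace x) }
      ; h∈trace = λ { (a ∷ x) → tail∈trace p q a (M.h∈trace x) } }
      where module M = Move m

  -- Makes each step of `growth` cost at most a factor `rate d * N`: the product is the dilation
  -- without its factor `N`, times the degree, and the leading 1 absorbs the 1 in `growth`.
  rate : ℕ → ℕ
  rate d = 1 + (2 + d) * 3 ^ d

  module _ {n : ℕ} where

    -- The head is contracted to `p` first, then the tail to `q`. The moves written out separately
    -- join pointwise equal maps, such as `onHead (const p)` and `onTail p id`.
    grid-contract : ∀ {d} (p : Vec (Fin (suc n)) d) → Star (GridMove p) id (const p)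
    grid-contract [] = record
      { source  = id ; target = λ _ → [] ; across = λ { [] → [] }
      ; g∈trace = start∈trace [] ; h∈trace = end∈trace [] } ◅ ε
    grid-contract (p ∷ q) =
      record
        { source  = id ; target = λ { (r ∷ rs) → r ∷ rs } ; across = λ { (r ∷ rs) → r ∷ rs }
        ; g∈trace = start∈trace (p ∷ q) ; h∈trace = λ { (a ∷ x) → start∈trace (p ∷ q) (a ∷ x) } }
      ◅ gmap (λ g → onHead g) (head-move p q) (line-contract p)
      ◅◅ record
        { source  = λ { (r ∷ rs) → near-refl ∷ rs }
        ; target  = λ { (r ∷ rs) → near-refl ∷ rs }
        ; across  = λ { (r ∷ rs) → near-refl ∷ rs }
        ; g∈trace = λ { (a ∷ x) → head∈trace p q a p x }
        ; h∈trace = λ { (a ∷ x) → head∈trace p q a p x } }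
      ◅ gmap (onTail p) (tail-move p q) (grid-contract q)
      ◅◅ record
        { source  = λ { (r ∷ rs) → adj-refl }
        ; target  = λ _ → adj-refl
        ; across  = λ { (r ∷ rs) → adj-refl }
        ; g∈trace = λ { (a ∷ x) → end∈trace (p ∷ q) (a ∷ x) }
        ; h∈trace = end∈trace (p ∷ q) } ◅ ε

    grid-contractible : ∀ d → Contractible (Vec (Fin (suc n)) d)
    grid-contractible d = record
      { _~_       = Adj
      ; ~-refl    = adj-refl
      ; ~-sym     = adj-sym
      ; trace     = trace
      ; end∈trace = end∈trace
      ; contract  = grid-contract
      }

    private N = suc n

    -- Counts, for each `y`, the pairs of `p` and `x` whose trace passes through `y`. On the initial
    -- line the tail of `x` is that of `y`, while its head and all of `p` are free. Afterwards the
    -- head of `p` is that of `y`, the head of `x` is free, and the tails are counted by induction.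
    ∑-trace : ∀ d (f : Vec (Fin N) d → ℕ) →
      ∑ (grid d) (λ p → ∑ (grid d) (λ x → ∑ (trace p x) f)) ≤ suc d * N ^ suc d * ∑ (grid d) f
    ∑-trace zero    f = begin
      f [] + 0 + 0 + 0                  ≡⟨ trans (+-identityʳ _) (+-identityʳ _) ⟩
      f [] + 0                          ≤⟨ m≤n*m (f [] + 0) (1 * N ^ 1) {{m*n≢0 1 (N ^ 1)}} ⟩
      1 * N ^ 1 * (f [] + 0)            ∎
      where open ≤-Reasoning
    ∑-trace (suc d) f = begin
      ∑ (grid (suc d)) (λ p → ∑ (grid (suc d)) (λ x → ∑ (trace p x) f))
        ≡⟨ ∑-grid {N} d _ ⟩
      ∑ F (λ p → ∑ P (λ q → ∑ (grid (suc d)) (λ x → ∑ (trace (p ∷ q) x) f)))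
        ≡⟨ ∑-cong F (λ p → ∑-cong P (λ q → inner p q)) ⟩
      ∑ F (λ p → ∑ P (λ q → N * T + N * U p q))
        ≡⟨ ∑-cong F (λ p → trans (∑-+ P _ _)
             (cong₂ _+_ (trans (∑-const P _) (cong (_* (N * T)) (length-grid {N} d))) (∑-* P N _))) ⟩
      ∑ F (λ p → N ^ d * (N * T) + N * ∑ P (U p))
        ≡⟨ ∑-+ F (λ _ → N ^ d * (N * T)) (λ p → N * ∑ P (U p)) ⟩
      ∑ F (λ p → N ^ d * (N * T)) + ∑ F (λ p → N * ∑ P (U p))
        ≤⟨ +-mono-≤ (≤-reflexive (trans (∑-const F _) (cong (_* (N ^ d * (N * T))) (length-allFin {N}))))
             (∑-mono F (λ p → *-monoʳ-≤ N (∑-trace d (f ∘ (p ∷_))))) ⟩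
      N * (N ^ d * (N * T)) + ∑ F (λ p → N * (suc d * N ^ suc d * ∑ P (f ∘ (p ∷_))))
        ≡⟨ cong (N * (N ^ d * (N * T)) +_) (trans (∑-* F N _) (cong (N *_) (∑-* F (suc d * N ^ suc d) _))) ⟩
      N * (N ^ d * (N * T)) + N * (suc d * N ^ suc d * ∑ F (λ p → ∑ P (f ∘ (p ∷_))))
        ≡⟨ cong (λ s → N * (N ^ d * (N * T)) + N * (suc d * N ^ suc d * s)) (sym (∑-grid {N} d f)) ⟩
      N * (N ^ d * (N * T)) + N * (suc d * N ^ suc d * T)
        ≡⟨ solve 4 (λ a b c t → a :* (b :* (a :* t)) :+ a :* ((con 1 :+ c) :* (a :* b) :* t)
             := (con 2 :+ c) :* (a :* (a :* b)) :* t) refl N (N ^ d) d T ⟩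
      suc (suc d) * N ^ suc (suc d) * T ∎
      where
      open ≤-Reasoning
      open +-*-Solver using (solve; con; _:+_; _:*_; _:=_)
      F = allFin N
      P = grid d
      T = ∑ (grid (suc d)) f
      U : Fin N → Vec (Fin N) d → ℕ
      U p q = ∑ P (λ x → ∑ (trace q x) (f ∘ (p ∷_)))
      inner : ∀ p q → ∑ (grid (suc d)) (λ x → ∑ (trace (p ∷ q) x) f) ≡ N * T + N * U p q
      inner p q = begin-equality
        ∑ (grid (suc d)) (λ x → ∑ (trace (p ∷ q) x) f)
          ≡⟨ ∑-grid {N} d _ ⟩
        ∑ F (λ a → ∑ P (λ x → ∑ (trace (p ∷ q) (a ∷ x)) f))
          ≡⟨ ∑-const F _ ⟩
        length F * ∑ P (λ x → ∑ (map (_∷ x) F ++ map (p ∷_) (trace q x)) f)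
          ≡⟨ cong₂ _*_ (length-allFin {N}) (∑-cong P (λ x → trans (∑-++ (map (_∷ x) F) _ f)
               (cong₂ _+_ (∑-map (_∷ x) F f) (∑-map (p ∷_) (trace q x) f)))) ⟩
        N * ∑ P (λ x → ∑ F (λ a → f (a ∷ x)) + ∑ (trace q x) (f ∘ (p ∷_)))
          ≡⟨ cong (N *_) (∑-+ P _ _) ⟩
        N * (∑ P (λ x → ∑ F (λ a → f (a ∷ x))) + U p q)
          ≡⟨ cong (λ s → N * (s + U p q)) (trans (∑-swap P F _) (sym (∑-grid {N} d f))) ⟩
        N * (T + U p q)
          ≡⟨ *-distribˡ-+ N T (U p q) ⟩
        N * T + N * U p q ∎

    -- On average over `p`, the shadow has at most `(1 + d) * N * s` points by `∑-trace`, and the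
    -- second summand of `cost` equals `N * s`. Some `p` stays below the sum of the two, which gives
    -- the factor `2 + d`.
    grid-centre : ∀ d (Z : Vec (Fin N) d → Bool) →
      ∃ λ p → ∑ (grid d) (λ x → ⟦ any Z (trace p x) ⟧) ≤ (2 + d) * N * ∑ (grid d) (⟦_⟧ ∘ Z) ×
              (Z p ≡ true → length (grid {N} d) ≤ (2 + d) * ∑ (grid d) (⟦_⟧ ∘ Z))
    grid-centre d Z = let p , cost≤ = average (grid d) (length-grid {N} d) total in
      p , ≤-trans (m≤m+n _ _) cost≤ , inside p cost≤
      where
      open ≤-Reasoning
      s = ∑ (grid d) (⟦_⟧ ∘ Z)
      -- The second summand makes a centre p inside Z affordable only if Z is large.
      cost : Vec (Fin N) d → ℕ
      cost p = ∑ (grid d) (λ x → ⟦ any Z (trace p x) ⟧) + N ^ suc d * ⟦ Z p ⟧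

      total : ∑ (grid d) cost ≤ N ^ d * ((2 + d) * N * s)
      total = begin
        ∑ (grid d) cost
          ≡⟨ trans (∑-+ (grid d) _ _) (cong₂ _+_ refl (∑-* (grid d) (N ^ suc d) _)) ⟩
        ∑ (grid d) (λ p → ∑ (grid d) (λ x → ⟦ any Z (trace p x) ⟧)) + N ^ suc d * s
          ≤⟨ +-monoˡ-≤ (N ^ suc d * s) (≤-trans
               (∑-mono (grid d) (λ p → ∑-mono (grid d) (λ x → any≤∑ Z (trace p x))))
               (∑-trace d (⟦_⟧ ∘ Z))) ⟩
        suc d * N ^ suc d * s + N ^ suc d * s
          ≡⟨ solve 4 (λ d a b s → (con 1 :+ d) :* (a :* b) :* s :+ (a :* b) :* s
               := b :* ((con 2 :+ d) :* a :* s)) refl d N (N ^ d) s ⟩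
        N ^ d * ((2 + d) * N * s) ∎
        where open +-*-Solver using (solve; con; _:+_; _:*_; _:=_)

      average : ∀ ps → length ps ≡ N ^ d → ∑ ps cost ≤ N ^ d * ((2 + d) * N * s) →
        ∃ λ p → cost p ≤ (2 + d) * N * s
      average []       e le = contradiction (sym e) (ℕ.≢-nonZero⁻¹ (N ^ d) {{m^n≢0 N d}})
      average (p ∷ ps) e le = ∑-average p ps cost _ (subst (λ l → ∑ (p ∷ ps) cost ≤ l * ((2 + d) * N * s)) (sym e) le)

      inside : ∀ p → cost p ≤ (2 + d) * N * s → Z p ≡ true → length (grid d) ≤ (2 + d) * s
      inside p cost≤ Zp = *-cancelˡ-≤ N (begin
        N * length (grid d)
          ≡⟨ cong (N *_) (length-grid {N} d) ⟩
        N ^ suc d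
          ≡⟨ sym (*-identityʳ _) ⟩
        N ^ suc d * 1
          ≡⟨ cong (λ b → N ^ suc d * ⟦ b ⟧) (sym Zp) ⟩
        N ^ suc d * ⟦ Z p ⟧
          ≤⟨ m≤n+m _ _ ⟩
        cost p
          ≤⟨ cost≤ ⟩
        (2 + d) * N * s
          ≡⟨ solve 3 (λ d a s → (con 2 :+ d) :* a :* s := a :* ((con 2 :+ d) :* s)) refl d N s ⟩
        N * ((2 + d) * s) ∎)
        where open +-*-Solver using (solve; con; _:+_; _:*_; _:=_)

    grid-space : ∀ d → Space (Vec (Fin N) d)
    grid-space d = record
      { contractible = grid-contractible d
      ; _≟_          = Vec.≡-dec Fin._≟_
      ; points       = grid d
      ; unique       = grid-unique d
      ; complete     = grid-complete
      ; _~?_         = adj?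
      ; degree       = 3 ^ d
      ; degree-bound = grid-degree
      ; dilation     = (2 + d) * N
      ; capacity     = 2 + d
      ; centre       = grid-centre d
      }

    grid-growth : ∀ d j → Space.growth (grid-space d) j ≤ (rate d * N) ^ j
    grid-growth d zero    = ≤-refl
    grid-growth d (suc j) = begin
      1 + (2 + d) * N * growth j * 3 ^ d
        ≤⟨ +-mono-≤ (m^n>0 (rate d * N) j) (*-monoˡ-≤ (3 ^ d) (*-monoʳ-≤ ((2 + d) * N) (grid-growth d j))) ⟩
      X + (2 + d) * N * X * 3 ^ d
        ≤⟨ +-monoˡ-≤ _ (m≤n*m X N) ⟩
      N * X + (2 + d) * N * X * 3 ^ d
        ≡⟨ solve 4 (λ a b c x → a :* x :+ b :* a :* x :* c := (con 1 :+ b :* c) :* a :* x) refl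
             N (2 + d) (3 ^ d) X ⟩
      rate d * N * X ∎
      where
      open ≤-Reasoning
      open +-*-Solver using (solve; con; _:+_; _:*_; _:=_)
      open Space (grid-space d) using (growth)
      X = (rate d * N) ^ j

open import Defs
open import Data.Nat using (ℕ; suc; _∸_; _^_; _<_; _≥_)
open import Data.Product using (Σ; ∃; _×_)
open import Data.List using (List; length)
open import Data.List.Relation.Unary.All using (All)
open import Data.List.Relation.Unary.Unique.Propositional using (Unique)
open import Data.Rational using (ℚ; 0ℚ; _*_; _≤_; _<_)

-- From a colouring of the small cubes to a large monochromatic component.

module Colourings where

  open FiniteSums
  open Waists
  open Components
  open Grids
  open import Data.Fin using (Fin; zero)
  import Data.Fin.Properties as Fin
  open import Data.List using (filter; map)
  open import Data.List.Properties using (length-map)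
  open import Data.List.Relation.Unary.All.Properties using (all-filter; map⁺)
  import Data.List.Relation.Unary.All as All
  import Data.List.Relation.Unary.Unique.Propositional.Properties as Unique
  open import Data.Nat using (zero; _+_; ∣_-_∣)
  import Data.Nat as ℕ
  open import Data.Nat.Properties hiding (_≟_)
  open import Data.Nat.Solver using (module +-*-Solver)
  open import Data.Product using (_,_; proj₁; proj₂)
  open import Data.Vec using (Vec; lookup; tabulate; replicate)
  open import Data.Vec.Properties using (tabulate∘lookup)
  import Data.Vec.Relation.Binary.Pointwise.Inductive as Pointwise
  open import Function using (_∘_)
  open import Relation.Binary.Construct.Closure.ReflexiveTransitive using (Star; gmap; reverse; fold)
  open import Relation.Binary.PropositionalEquality
  open import Relation.Nullary.Decidable using (_×-dec_)

  ∣-∣≤1 : ∀ a b → a ℕ.≤ suc b → b ℕ.≤ suc a → ∣ a - b ∣ ℕ.≤ 1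
  ∣-∣≤1 zero    b       p q = q
  ∣-∣≤1 (suc a) zero    p q = p
  ∣-∣≤1 (suc a) (suc b) p q = ∣-∣≤1 a b (≤-pred p) (≤-pred q)

  lookup-injective : ∀ {A : Set} {d} {x y : Vec A d} → lookup x ≡ lookup y → x ≡ y
  lookup-injective {x = x} {y} e =
    trans (sym (tabulate∘lookup x)) (trans (cong tabulate e) (tabulate∘lookup y))

  ^-distribʳ-* : ∀ j a b → (a ℕ.* b) ^ j ≡ a ^ j ℕ.* b ^ j
  ^-distribʳ-* zero    a b = refl
  ^-distribʳ-* (suc j) a b rewrite ^-distribʳ-* j a b =
    solve 4 (λ a b c d → a :* b :* (c :* d) := a :* c :* (b :* d)) refl a b (a ^ j) (b ^ j)
    where open +-*-Solver

  -- The product of the capacity, the growth after `m` steps without its power of `N`, and the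
  -- degree.
  denominator : ℕ → ℕ → ℕ
  denominator d m = (2 + d) ℕ.* (rate d ^ m ℕ.* 3 ^ d)

  module _ {d m n : ℕ} (m≤d : m ℕ.≤ d) (χ : Coloring d (suc n) (suc m)) where

    private
      N = suc n
      S = grid-space {n} d
    open Space S using (_≟_; growth; size; points)

    -- Without function extensionality χ may distinguish pointwise equal cubes, so only the cubes of the
    -- form lookup x are used.
    Edge : Vec (Fin N) d → Vec (Fin N) d → Set
    Edge x y = Adj x y × χ (lookup x) ≡ χ (lookup y)

    edge-sym : ∀ {x y} → Edge x y → Edge y x
    edge-sym (a , c) = adj-sym a , sym c

    edge-mono : ∀ {x y} → Edge x y → MonoStep χ (lookup x) (lookup y)
    edge-mono {x} {y} (a , c) = (λ j → let p , q = Pointwise.lookup a j in ∣-∣≤1 _ _ p q) , c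

    private
      comps = components _≟_ edge-sym (λ x y → adj? x y ×-dec (χ (lookup x) Fin.≟ χ (lookup y))) grid-complete
      label = proj₁ comps
      reach = proj₁ (proj₂ comps)

    star-colour : ∀ {x y} → Star Edge x y → χ (lookup x) ≡ χ (lookup y)
    star-colour = fold (λ x y → χ (lookup x) ≡ χ (lookup y)) (λ e → trans (proj₂ e)) refl

    labelling : Labelling (grid-contractible {n} d) (suc m)
    labelling = record
      { colour       = χ ∘ lookup
      ; label        = label
      ; colour-label = λ x → sym (star-colour (reach x))
      ; label-local  = λ a c → proj₂ (proj₂ comps) (a , c)
      }

    large-component : Σ (Cube d N) λ c → Σ (List (Cube d N)) λ xs →
      Unique xs × All (InComponent χ c) xs × N ^ (d ∸ m) ℕ.≤ denominator d m ℕ.* length xs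
    large-component = lookup v , map lookup members ,
      Unique.map⁺ lookup-injective (Unique.filter⁺ inClass? (grid-unique d)) ,
      map⁺ (All.map in-component (all-filter inClass? points)) ,
      subst (λ l → N ^ (d ∸ m) ℕ.≤ denominator d m ℕ.* l)
            (trans (∑≡length-filter inClass? points) (sym (length-map lookup members)))
            -- The growth over `m` steps brings in the factor `N ^ m`. It is split off from the
            -- total `N ^ d` and cancelled.
            (*-cancelˡ-≤ (N ^ m) {{m^n≢0 N m}} size-bound)
      where
      found = large-class S labelling refl (replicate d zero)
      v = proj₁ found
      inClass? = λ x → label x ≟ v
      members = filter inClass? points
      s = size (class S labelling v)
      in-component : ∀ {x} → label x ≡ v → InComponent χ (lookup v) (lookup x)
      in-component {x} e = subst (λ u → InComponent χ (lookup u) (lookup x)) e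
        -- The path `reach x` runs from `x` to its label, whereas the component is based at the
        -- label.
        (gmap lookup edge-mono (reverse edge-sym (reach x)))
      open ≤-Reasoning
      open +-*-Solver using (solve; _:*_; _:=_)
      size-bound : N ^ m ℕ.* N ^ (d ∸ m) ℕ.≤ N ^ m ℕ.* (denominator d m ℕ.* s)
      size-bound = begin
        N ^ m ℕ.* N ^ (d ∸ m)
          ≡⟨ sym (^-distribˡ-+-* N m (d ∸ m)) ⟩
        N ^ (m + (d ∸ m))
          ≡⟨ cong (N ^_) (m+[n∸m]≡n m≤d) ⟩
        N ^ d
          ≡⟨ sym (length-grid d) ⟩
        length points
          ≤⟨ proj₂ found ⟩
        (2 + d) ℕ.* (growth m ℕ.* (3 ^ d ℕ.* s))
          ≤⟨ *-monoʳ-≤ (2 + d) (*-monoˡ-≤ (3 ^ d ℕ.* s) (grid-growth d m)) ⟩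
        (2 + d) ℕ.* ((rate d ℕ.* N) ^ m ℕ.* (3 ^ d ℕ.* s))
          ≡⟨ cong (λ y → (2 + d) ℕ.* (y ℕ.* (3 ^ d ℕ.* s))) (^-distribʳ-* m (rate d) N) ⟩
        (2 + d) ℕ.* (rate d ^ m ℕ.* N ^ m ℕ.* (3 ^ d ℕ.* s))
          ≡⟨ solve 5 (λ a r p t s → a :* (r :* p :* (t :* s)) := p :* (a :* (r :* t) :* s)) refl
               (2 + d) (rate d ^ m) (N ^ m) (3 ^ d) s ⟩
        N ^ m ℕ.* (denominator d m ℕ.* s) ∎

-- Unit fractions in ℚ.

module Fractions where

  open import Data.Integer using (+_; +≤+)
  import Data.Integer as ℤ
  import Data.Integer.Properties as ℤ
  import Data.Nat as ℕ
  import Data.Nat.Properties as ℕ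
  open import Data.Rational using (fromℚᵘ; toℚᵘ)
  open import Data.Rational.Properties using (toℚᵘ-cancel-≤; toℚᵘ-homo-*; toℚᵘ-fromℚᵘ; positive⁻¹; normalize-pos)
  open import Data.Rational.Unnormalised using (mkℚᵘ; *≤*)
  import Data.Rational.Unnormalised as ℚᵘ
  import Data.Rational.Unnormalised.Properties as ℚᵘ
  open import Relation.Binary.PropositionalEquality

  1/suc : ℕ → ℚ
  1/suc c = fromℚᵘ (mkℚᵘ (+ 1) c)

  1/suc-positive : ∀ c → 0ℚ Data.Rational.< 1/suc c
  1/suc-positive c = positive⁻¹ (1/suc c) {{normalize-pos 1 (suc c)}}

  -- In unnormalised fractions the inequality becomes the hypothesis after cross-multiplication.
  1/suc-*-≤ : ∀ c {k s} → k ℕ.≤ suc c ℕ.* s → 1/suc c * ℕtoℚ k ≤ ℕtoℚ s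
  1/suc-*-≤ c {k} {s} le = toℚᵘ-cancel-≤ (begin
    toℚᵘ (1/suc c * ℕtoℚ k)
      ≃⟨ toℚᵘ-homo-* (1/suc c) (ℕtoℚ k) ⟩
    toℚᵘ (1/suc c) ℚᵘ.* toℚᵘ (ℕtoℚ k)
      ≃⟨ ℚᵘ.*-cong (toℚᵘ-fromℚᵘ (mkℚᵘ (+ 1) c)) (toℚᵘ-fromℚᵘ (mkℚᵘ (+ k) 0)) ⟩
    mkℚᵘ (+ 1) c ℚᵘ.* mkℚᵘ (+ k) 0
      ≤⟨ *≤* (subst₂ ℤ._≤_ numerator denominator (+≤+ le)) ⟩
    mkℚᵘ (+ s) 0
      ≃⟨ ℚᵘ.≃-sym (toℚᵘ-fromℚᵘ (mkℚᵘ (+ s) 0)) ⟩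
    toℚᵘ (ℕtoℚ s) ∎)
    where
    open ℚᵘ.≤-Reasoning
    numerator : + k ≡ (+ 1 ℤ.* + k) ℤ.* + 1
    numerator = sym (trans (ℤ.*-identityʳ _) (ℤ.*-identityˡ (+ k)))
    denominator : + (suc c ℕ.* s) ≡ + s ℤ.* + (suc c ℕ.* 1)
    denominator = trans (cong +_ (trans (ℕ.*-comm (suc c) s) (cong (s ℕ.*_) (sym (ℕ.*-identityʳ (suc c))))))
                        (ℤ.pos-* s (suc c ℕ.* 1))

open import Data.Nat.Properties using (<⇒≤; ≤-trans; *-monoˡ-≤; n≤1+n)
open import Data.Product using (_,_)
open Colourings using (denominator; large-component)
open Fractions

theorem1p2 : (d m : ℕ) → d ≥ 1 → m Data.Nat.< d →
    Σ ℚ λ f → (0ℚ Data.Rational.< f) ×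
    ((n : ℕ) → n ≥ 1 → (χ : Coloring d n (suc m)) →
    Σ (Cube d n) λ c → Σ (List (Cube d n)) λ xs →
    Unique xs × All (InComponent χ c) xs ×
    (f * ℕtoℚ (n ^ (d ∸ m)) Data.Rational.≤ ℕtoℚ (length xs)))
theorem1p2 d m _ m<d = 1/suc (denominator d m) , 1/suc-positive (denominator d m) , λ where
  (suc n) _ χ →
    let c , xs , unique , component , le = large-component (<⇒≤ m<d) χ
    in c , xs , unique , component ,
       -- The constant is the reciprocal of `suc (denominator d m)`, which is nonzero by its form,
       -- so the bound is weakened by one.
       1/suc-*-≤ (denominator d m) (≤-trans le (*-monoˡ-≤ (length xs) (n≤1+n (denominator d m))))
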